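{- Let $T$ be a tree on $m$ edges and let $G$ be a bipartite graph admitting a $T$-equitable colouring. If, in this colouring, $d_i(v)\ge 10^{50m}$ for every vertex $v\in V(G)$ and every colour $i\in E(T)$, then $G$ has a $T$-decomposition.
   Context: All graphs are finite and simple. Fix a bipartition $(A,B)$ of $G$ and a bipartition $(T_A,T_B)$ of $T$. Vertices $v\in V(G)$ and $t\in V(T)$ are compatible if $v\in A$ and $t\in T_A$, or $v\in B$ and $t\in T_B$. For $t\in V(T)$, $S(t)$ denotes the set of edges of $T$ incident with $t$. Given an (improper) edge-colouring $\phi:E(G)\to E(T)$ and a colour $i\in E(T)$, $d_i(v)$ denotes the number of edges of colour $i$ incident with $v$. The colouring $\phi$ is $T$-equitable if for all compatible $v\in V(G)$, $t\in V(T)$ and all $j,k\in S(t)$ we have $d_j(v)=d_k(v)$. A $T$-decomposition of $G$ is a partition of $E(G)$ into parts each isomorphic to $T$. -}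

module Defs where

open import Data.Nat using (ℕ; zero; suc; _+_; _*_; _^_; _≤_)
open import Data.Bool using (Bool; true; false; if_then_else_; _∧_)
open import Data.Fin using (Fin; zero; suc; toℕ; inject₁; fromℕ; _<_; _<?_; _≟_)
open import Data.Fin.Properties using (<-cmp)
open import Data.List using (List; map; allFin)
open import Data.Nat.ListAction using (sum)
open import Data.Product using (Σ; Σ-syntax; _×_; _,_; proj₁; proj₂)
open import Data.Sum using (_⊎_)
open import Data.Empty using (⊥; ⊥-elim)
open import Relation.Nullary using (¬_)
open import Relation.Nullary.Decidable using (⌊_⌋)
open import Relation.Binary.Definitions using (tri<; tri≈; tri>)
open import Relation.Binary.PropositionalEquality using (_≡_; _≢_; refl; sym; trans; subst)

record Graph : Set where
  field
    n     : ℕ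
    adj   : Fin n → Fin n → Bool
    adj-sym : ∀ u v → adj u v ≡ adj v u
    irref : ∀ v → adj v v ≡ false
open Graph public

V : Graph → Set
V G = Fin (n G)

Adj : (G : Graph) → V G → V G → Set
Adj G u v = adj G u v ≡ true

-- An edge {u,v} is represented uniquely as (u , v) with u < v.
record Edge (G : Graph) : Set where
  constructor edge
  field
    lo  : V G
    hi  : V G
    lt  : lo < hi
    isE : Adj G lo hi
open Edge public

mkEdge : (G : Graph) (x y : V G) → Adj G x y → Edge G
mkEdge G x y h with <-cmp x y
... | tri< a _ _ = edge x y a h
... | tri> _ _ c = edge y x c (trans (adj-sym G y x) h)
... | tri≈ _ refl _ = ⊥-elim (bad (trans (sym h) (irref G x)))
  where
  bad : true ≡ false → ⊥
  bad ()

sameEdge : {G : Graph} → Edge G → Edge G → Bool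
sameEdge e f = ⌊ lo e ≟ lo f ⌋ ∧ ⌊ hi e ≟ hi f ⌋

ΣF : (k : ℕ) → (Fin k → ℕ) → ℕ
ΣF k f = sum (map f (allFin k))

edgeCount : Graph → ℕ
edgeCount G = ΣF (n G) λ u → ΣF (n G) λ v →
  if adj G u v ∧ ⌊ u <? v ⌋ then 1 else 0

data Walk (G : Graph) : V G → V G → Set where
  nil  : ∀ {u} → Walk G u u
  cons : ∀ {u w v} → Adj G u w → Walk G w v → Walk G u v

Connected : Graph → Set
Connected G = ∀ u v → Walk G u v

record Cycle (G : Graph) : Set where
  field
    k      : ℕ
    k≥2    : 2 ≤ k
    c      : Fin (suc k) → V G
    c-inj  : ∀ i j → c i ≡ c j → i ≡ j
    c-adj  : ∀ (i : Fin k) → Adj G (c (inject₁ i)) (c (suc i))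
    c-close : Adj G (c (fromℕ k)) (c zero)

IsTree : Graph → Set
IsTree T = (1 ≤ n T) × Connected T × ¬ Cycle T

IsBipartition : (G : Graph) → (V G → Bool) → Set
IsBipartition G side = ∀ u v → Adj G u v → side u ≢ side v

Colouring : Graph → Graph → Set
Colouring G T = Edge G → Edge T

degInd : (G T : Graph) → Colouring G T → Edge T → V G → V G → ℕ
degInd G T φ i v w with adj G v w in eq
... | false = 0
... | true  = if sameEdge (φ (mkEdge G v w eq)) i then 1 else 0

deg : (G T : Graph) → Colouring G T → Edge T → V G → ℕ
deg G T φ i v = ΣF (n G) (degInd G T φ i v)

Incident : (T : Graph) → V T → Edge T → Set
Incident T t j = (lo j ≡ t) ⊎ (hi j ≡ t)

-- φ is T-equitable w.r.t. bipartitions sG of G and sT of T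
-- (v and t compatible iff sG v ≡ sT t)
Equitable : (G T : Graph) (sG : V G → Bool) (sT : V T → Bool) → Colouring G T → Set
Equitable G T sG sT φ = ∀ (v : V G) (t : V T) → sG v ≡ sT t →
  ∀ (j k : Edge T) → Incident T t j → Incident T t k →
  deg G T φ j v ≡ deg G T φ k v

-- A T-decomposition of G: a partition of E(G) into k parts (part e = index of
-- the part containing e), where part p is the image of T under an injective
-- vertex map emb p : V T → V G that maps edges of T exactly onto the edges of part p.
record TDecomposition (T G : Graph) : Set where
  field
    k        : ℕ
    part     : Edge G → Fin k
    emb      : Fin k → V T → V G
    emb-inj  : ∀ p a b → emb p a ≡ emb p b → a ≡ b
    emb-edge : ∀ p a b → Adj T a b →
               Σ (Adj G (emb p a) (emb p b)) λ h → part (mkEdge G _ _ h) ≡ p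
    emb-onto : ∀ (e : Edge G) → Σ (V T) λ a → Σ (V T) λ b →
               Adj T a b × (lo e ≡ emb (part e) a) × (hi e ≡ emb (part e) b)

module Submission where

open import Defs
open import Data.Nat using (ℕ; zero; suc; _+_; _*_; _^_; _≤_; _<_; z≤n; s≤s)
open import Data.Nat.Properties using
  ( ≤-refl; ≤-reflexive; ≤-trans; ≤-pred; ≤-antisym; ≤-irrelevant; <-asym; m≤m+n; m≤n+m
  ; 0≢1+n; +-suc; +-identityʳ; +-mono-≤; +-monoʳ-≤; +-cancelʳ-≤
  ; *-comm; *-assoc; *-identityˡ; *-identityʳ; *-zeroʳ; *-mono-≤; *-monoˡ-≤; *-monoʳ-≤; *-cancelˡ-≤
  ; ^-monoˡ-≤; ^-monoʳ-≤; ^-distribˡ-+-*; m^n>0; +-*-semiring; module ≤-Reasoning)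
open import Data.Nat.Tactic.RingSolver using (solve-∀)
import Data.Nat.ListAction as ListAction
open import Algebra.Properties.Semiring.Sum +-*-semiring using
  (sum; sum-cong-≗; ∑-comm; ∑-distrib-+; *-distribˡ-sum; *-distribʳ-sum)
open import Axiom.UniquenessOfIdentityProofs.WithK using (uip)
open import Data.Bool using (Bool; true; false; _∧_; if_then_else_)
import Data.Bool.Properties as Bool
open import Data.Empty using (⊥-elim)
open import Data.Fin using (Fin; zero; suc; inject₁; fromℕ; _<?_; combine; remQuot; funToFin; finToFun)
open import Data.Fin.Permutation.Components using (transpose; transpose-inverse)
open import Data.Fin.Properties using
  ( _≟_; <-cmp; any?; all?; suc-injective; finToFun-funToFin; funToFin-finToFin
  ; combine-injective; combine-surjective; combine-remQuot; remQuot-combine)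
open import Data.List using (List; []; _∷_; length; _++_; allFin; tabulate)
import Data.List.Membership.DecPropositional as DecMembership
open import Data.List.Membership.Propositional using (_∈_; _∉_)
open import Data.List.Membership.Propositional.Properties using (∈-++⁺ˡ; ∈-++⁺ʳ; ∈-allFin)
open import Data.List.Properties using (map-tabulate)
open import Data.List.Relation.Unary.Any using (here; there)
open import Data.Product using (Σ; ∃; ∃₂; _×_; _,_; proj₁; proj₂)
open import Data.Sum using (_⊎_; inj₁; inj₂)
open import Data.Unit using (⊤; tt)
open import Data.Vec using (Vec; []; _∷_; lookup)
open import Function using (_∘_; id; _∋_)
open import Relation.Binary.Definitions using (tri<; tri≈; tri>)
open import Relation.Binary.PropositionalEquality using
  ( _≡_; _≢_; refl; sym; trans; cong; cong₂; subst; subst₂; subst-injective; subst-subst-sym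
  ; module ≡-Reasoning)
open import Relation.Nullary using (¬_; Dec; yes; no; does; ¬?)
open import Relation.Nullary.Decidable using (⌊_⌋; map′; _×-dec_; _→-dec_)
open import Relation.Unary using (Decidable)

-- Let Ω be the set of all splittings of G into colour-respecting homomorphic copies of T; it is
-- nonempty because equal colour degrees let the copies be extended edge by edge along T.  Call a
-- copy bad if it is not injective, and for a set Y of edges of G let a(Y) count the members of Ω
-- all of whose bad copies meet Y.  Then a(E(G)) = |Ω| > 0, and a(∅) > 0 is wanted, so it suffices
-- that a(Y ∪ {e}) ≤ 2 a(Y), which is shown by induction on the number of edges outside Y (a form
-- of the lopsided local lemma).  The loss a(Y ∪ {e}) - a(Y) counts splittings in which the copy at e
-- is bad.  For a fixed copy h through e, switching branches of copies shows that at most a(Y ∪ h) / w(h)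
-- of them contain h, where w(h) is the product of the degrees met while exploring T from e, and
-- a(Y ∪ h) ≤ 2ⁿ a(Y ∪ {e}) by induction.  Summing 1 / w(h) over all h gives 1, but for bad h some
-- step of the exploration has at most n choices out of at least 10^(50m), so the loss is at most
-- n² 2ⁿ a(Y ∪ {e}) / 10^(50m), which is at most half of a(Y ∪ {e}).

private variable
  k l : ℕ

-- Counting

*-cancelˡ-positive : ∀ d {a b} → 1 ≤ d → d * a ≤ d * b → a ≤ b
*-cancelˡ-positive (suc d) _ = *-cancelˡ-≤ (suc d)

scale-assoc : ∀ κ d q B → κ * d * (q * B) ≡ κ * (d * q * B)
scale-assoc = solve-∀

*-swap : ∀ d D z → d * (D * z) ≡ D * (d * z)
*-swap = solve-∀

double-assoc : ∀ c X → c * (2 * X) ≡ 2 * c * X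
double-assoc = solve-∀

*-regroup : ∀ n p A → n * (n * (p * A)) ≡ n * (n * p) * A
*-regroup = solve-∀

+-twice : ∀ G X → (G + X) + (G + X) ≡ 2 * G + 2 * X
+-twice = solve-∀

*-collect : ∀ n d M r → n * (d * M) + d * r ≡ d * (n * M + r)
*-collect = solve-∀

seven-fold : ∀ m → m + (2 * m + (2 * m + 2 * m)) ≡ 7 * m
seven-fold = solve-∀

sum-mono : {f g : Fin k → ℕ} → (∀ i → f i ≤ g i) → sum f ≤ sum g
sum-mono {zero}  f≤g = z≤n
sum-mono {suc k} f≤g = +-mono-≤ (f≤g zero) (sum-mono (f≤g ∘ suc))

term≤sum : (f : Fin k → ℕ) → ∀ i → f i ≤ sum f
term≤sum f zero    = m≤m+n _ _
term≤sum f (suc i) = ≤-trans (term≤sum (f ∘ suc) i) (m≤n+m _ (f zero))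

sum-≤-const : (f : Fin k → ℕ) (c : ℕ) → (∀ i → f i ≤ c) → sum f ≤ k * c
sum-≤-const {zero}  f c f≤c = z≤n
sum-≤-const {suc k} f c f≤c = +-mono-≤ (f≤c zero) (sum-≤-const (f ∘ suc) c (f≤c ∘ suc))

sum-zero : (f : Fin k → ℕ) → (∀ i → f i ≡ 0) → sum f ≡ 0
sum-zero {zero}  f f≡0 = refl
sum-zero {suc k} f f≡0 = cong₂ _+_ (f≡0 zero) (sum-zero (f ∘ suc) (f≡0 ∘ suc))

sum-≤-single : (f : Fin k → ℕ) (c : ℕ) → (∀ i → f i ≤ c) →
  (∀ i j → f i ≢ 0 → f j ≢ 0 → i ≡ j) → sum f ≤ c
sum-≤-single {zero} f c f≤c one = z≤n
sum-≤-single {suc k} f c f≤c one with f zero in eq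
... | zero  = sum-≤-single (f ∘ suc) c (f≤c ∘ suc)
                λ i j p q → suc-injective (one (suc i) (suc j) p q)
... | suc a = ≤-trans (≤-reflexive (trans (cong (suc a +_) (sum-zero (f ∘ suc) rest)) (trans (+-identityʳ _) (sym eq)))) (f≤c zero)
  where
  rest : ∀ i → f (suc i) ≡ 0
  rest i with f (suc i) in eq′
  ... | zero  = refl
  ... | suc b with () ← one zero (suc i) (λ p → 0≢1+n (trans (sym p) eq)) (λ p → 0≢1+n (trans (sym p) eq′))

𝟙 : {P : Set} → Dec P → ℕ
𝟙 (yes _) = 1
𝟙 (no _)  = 0

𝟙-yes : {P : Set} (d : Dec P) → P → 𝟙 d ≡ 1
𝟙-yes (yes _) p = refl
𝟙-yes (no ¬p) p = ⊥-elim (¬p p)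

𝟙-no : {P : Set} (d : Dec P) → ¬ P → 𝟙 d ≡ 0
𝟙-no (yes p) ¬p = ⊥-elim (¬p p)
𝟙-no (no _)  ¬p = refl

𝟙≢0 : {P : Set} (d : Dec P) → 𝟙 d ≢ 0 → P
𝟙≢0 (yes p) _  = p
𝟙≢0 (no _)  ne = ⊥-elim (ne refl)

𝟙≤1 : {P : Set} (d : Dec P) → 𝟙 d ≤ 1
𝟙≤1 (yes _) = ≤-refl
𝟙≤1 (no _)  = z≤n

𝟙-mono : {P Q : Set} (d : Dec P) (e : Dec Q) → (P → Q) → 𝟙 d ≤ 𝟙 e
𝟙-mono (yes p) e f = ≤-reflexive (sym (𝟙-yes e (f p)))
𝟙-mono (no _)  e f = z≤n

# : {P : Fin k → Set} → Decidable P → ℕ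
# P? = sum λ i → 𝟙 (P? i)

#-mono : {P Q : Fin k → Set} (P? : Decidable P) (Q? : Decidable Q) →
  (∀ i → P i → Q i) → # P? ≤ # Q?
#-mono P? Q? P⊆Q = sum-mono λ i → 𝟙-mono (P? i) (Q? i) (P⊆Q i)

#-< : {P Q : Fin k → Set} (P? : Decidable P) (Q? : Decidable Q) →
  (∀ i → P i → Q i) → ∀ i → ¬ P i → Q i → # P? < # Q?
#-< P? Q? P⊆Q zero ¬p q with P? zero | Q? zero
... | yes p | _     = ⊥-elim (¬p p)
... | no _  | no ¬q = ⊥-elim (¬q q)
... | no _  | yes _ = s≤s (#-mono (P? ∘ suc) (Q? ∘ suc) (P⊆Q ∘ suc))
#-< P? Q? P⊆Q (suc i) ¬p q = ≤-trans
  (≤-reflexive (sym (+-suc (𝟙 (P? zero)) _)))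
  (+-mono-≤ (𝟙-mono (P? zero) (Q? zero) (P⊆Q zero)) (#-< (P? ∘ suc) (Q? ∘ suc) (P⊆Q ∘ suc) i ¬p q))

#-≤-size : {P : Fin k → Set} (P? : Decidable P) → # P? ≤ k
#-≤-size {k} P? = ≤-trans (sum-≤-const _ 1 (λ i → 𝟙≤1 (P? i))) (≤-reflexive (*-identityʳ k))

#-zero : {P : Fin k → Set} (P? : Decidable P) → (∀ i → ¬ P i) → # P? ≡ 0
#-zero P? ¬P = sum-zero _ λ i → 𝟙-no (P? i) (¬P i)

#-positive : {P : Fin k → Set} (P? : Decidable P) → ∀ i → P i → 1 ≤ # P?
#-positive P? i p = ≤-trans (≤-reflexive (sym (𝟙-yes (P? i) p))) (term≤sum _ i)

#-witness : {P : Fin k → Set} (P? : Decidable P) → 1 ≤ # P? → ∃ P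
#-witness P? pos with any? P?
... | yes w = w
... | no ¬w with () ← subst (1 ≤_) (#-zero P? λ i p → ¬w (i , p)) pos

#-cover : {P Q R : Fin k → Set} (P? : Decidable P) (Q? : Decidable Q) (R? : Decidable R) →
  (∀ i → P i → Q i ⊎ R i) → # P? ≤ # Q? + # R?
#-cover {P = P} {Q} {R} P? Q? R? cov =
  ≤-trans (sum-mono pt) (≤-reflexive (∑-distrib-+ (λ i → 𝟙 (Q? i)) (λ i → 𝟙 (R? i))))
  where
  pt : ∀ i → 𝟙 (P? i) ≤ 𝟙 (Q? i) + 𝟙 (R? i)
  pt i with P? i
  ... | no _ = z≤n
  ... | yes p with cov i p
  ...   | inj₁ q = ≤-trans (≤-reflexive (sym (𝟙-yes (Q? i) q))) (m≤m+n _ _)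
  ...   | inj₂ r = ≤-trans (≤-reflexive (sym (𝟙-yes (R? i) r))) (m≤n+m _ (𝟙 (Q? i)))

-- Double counts the 0-1 matrix `c` of the graph of `f`: each row in `P` contains a 1, and
-- injectivity leaves at most one nonzero entry in a column.
#-injection : {P : Fin k → Set} {Q : Fin l → Set} (P? : Decidable P) (Q? : Decidable Q) →
  (f : ∀ i → P i → Fin l) → (∀ i p → Q (f i p)) →
  (∀ i j p q → f i p ≡ f j q → i ≡ j) → # P? ≤ # Q?
#-injection {k} {l} {P} {Q} P? Q? f f∈Q inj = begin
  sum (λ i → 𝟙 (P? i))    ≤⟨ sum-mono row ⟩
  sum (λ i → sum (c i))   ≡⟨ ∑-comm c ⟩
  sum (λ j → sum (λ i → c i j)) ≤⟨ sum-mono col ⟩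
  sum (λ j → 𝟙 (Q? j)) ∎
  where
  open ≤-Reasoning
  c : Fin k → Fin l → ℕ
  c i j with P? i
  ... | yes p = 𝟙 (f i p ≟ j)
  ... | no _  = 0
  row : ∀ i → 𝟙 (P? i) ≤ sum (c i)
  row i with P? i
  ... | no _  = z≤n
  ... | yes p = ≤-trans (≤-reflexive (sym (𝟙-yes (f i p ≟ f i p) refl))) (term≤sum (λ j → 𝟙 (f i p ≟ j)) (f i p))
  c≢0 : ∀ i j → c i j ≢ 0 → Σ (P i) λ p → f i p ≡ j
  c≢0 i j ne with P? i
  ... | no _  = ⊥-elim (ne refl)
  ... | yes p = p , 𝟙≢0 (f i p ≟ j) ne
  c≤ : ∀ i j → c i j ≤ 𝟙 (Q? j)
  c≤ i j with P? i
  ... | no _  = z≤n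
  ... | yes p = 𝟙-mono (f i p ≟ j) (Q? j) λ e → subst Q e (f∈Q i p)
  col : ∀ j → sum (λ i → c i j) ≤ 𝟙 (Q? j)
  col j = sum-≤-single (λ i → c i j) _ (λ i → c≤ i j) λ i i′ ne ne′ →
    let p , e = c≢0 i j ne ; p′ , e′ = c≢0 i′ j ne′ in inj i i′ p p′ (trans e (sym e′))

∑[_]_ : {R : Fin k → Set} → Decidable R → (Fin k → ℕ) → ℕ
∑[ R? ] F = sum λ w → 𝟙 (R? w) * F w

∑-lower : {R : Fin k → Set} (R? : Decidable R) (F : Fin k → ℕ) (c : ℕ) →
  (∀ w → R w → c ≤ F w) → # R? * c ≤ ∑[ R? ] F
∑-lower R? F c c≤F = ≤-trans (≤-reflexive (*-distribʳ-sum c (λ w → 𝟙 (R? w)))) (sum-mono pt)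
  where
  pt : ∀ w → 𝟙 (R? w) * c ≤ 𝟙 (R? w) * F w
  pt w with R? w
  ... | yes r = *-monoʳ-≤ 1 (c≤F w r)
  ... | no _  = z≤n

∑-upper : {R : Fin k → Set} (R? : Decidable R) (F : Fin k → ℕ) (c : ℕ) →
  (∀ w → R w → F w ≤ c) → ∑[ R? ] F ≤ # R? * c
∑-upper R? F c F≤c = ≤-trans (sum-mono pt) (≤-reflexive (sym (*-distribʳ-sum c (λ w → 𝟙 (R? w)))))
  where
  pt : ∀ w → 𝟙 (R? w) * F w ≤ 𝟙 (R? w) * c
  pt w with R? w
  ... | yes r = *-monoʳ-≤ 1 (F≤c w r)
  ... | no _  = z≤n

∑-scale : {R : Fin k → Set} (R? : Decidable R) (F : Fin k → ℕ) (c : ℕ) →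
  c * ∑[ R? ] F ≡ ∑[ R? ] (λ w → c * F w)
∑-scale R? F c = trans (*-distribˡ-sum c (λ w → 𝟙 (R? w) * F w)) (sum-cong λ w → swap (𝟙 (R? w)) (F w))
  where
  sum-cong : {f g : Fin k → ℕ} → (∀ i → f i ≡ g i) → sum f ≡ sum g
  sum-cong {zero} e = refl
  sum-cong {suc k} e = cong₂ _+_ (e zero) (sum-cong (e ∘ suc))
  swap : ∀ a b → c * (a * b) ≡ a * (c * b)
  swap a b = trans (sym (*-assoc c a b)) (trans (cong (_* b) (*-comm c a)) (*-assoc a c b))

-- The union bound over the classes `Q w`; it is applied with `w` the image of the next vertex of
-- the tree.
#-split-≤ : {P : Fin k → Set} {R : Fin l → Set} {Q : Fin l → Fin k → Set}
  (P? : Decidable P) (R? : Decidable R) (Q? : ∀ w → Decidable (Q w)) →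
  (∀ i → P i → ∃ λ w → R w × Q w i) → # P? ≤ ∑[ R? ] λ w → # (Q? w)
#-split-≤ {R = R} P? R? Q? ex = begin
  sum (λ i → 𝟙 (P? i))                                 ≤⟨ sum-mono row ⟩
  sum (λ i → sum λ w → 𝟙 (R? w) * 𝟙 (Q? w i))          ≡⟨ ∑-comm (λ i w → 𝟙 (R? w) * 𝟙 (Q? w i)) ⟩
  sum (λ w → sum λ i → 𝟙 (R? w) * 𝟙 (Q? w i))
    ≤⟨ sum-mono (λ w → ≤-reflexive (sym (*-distribˡ-sum (𝟙 (R? w)) (λ i → 𝟙 (Q? w i))))) ⟩
  sum (λ w → 𝟙 (R? w) * # (Q? w))                      ∎
  where
  open ≤-Reasoning
  row : ∀ i → 𝟙 (P? i) ≤ sum λ w → 𝟙 (R? w) * 𝟙 (Q? w i)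
  row i with P? i
  ... | no _  = z≤n
  ... | yes p with w , r , q ← ex i p =
    ≤-trans (≤-reflexive (sym (cong₂ _*_ (𝟙-yes (R? w) r) (𝟙-yes (Q? w i) q))))
            (term≤sum (λ w → 𝟙 (R? w) * 𝟙 (Q? w i)) w)

-- The classes need not exhaust `P`: disjointness alone ensures that each `i` is counted at most
-- once.
#-split-≥ : {P : Fin k → Set} {R : Fin l → Set} {Q : Fin l → Fin k → Set}
  (P? : Decidable P) (R? : Decidable R) (Q? : ∀ w → Decidable (Q w)) →
  (∀ w i → Q w i → P i) → (∀ w w′ i → Q w i → Q w′ i → w ≡ w′) →
  ∑[ R? ] (λ w → # (Q? w)) ≤ # P?
#-split-≥ {P = P} {R} {Q} P? R? Q? Q⊆P disj = begin
  sum (λ w → 𝟙 (R? w) * # (Q? w))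
    ≤⟨ sum-mono (λ w → ≤-trans (*-monoˡ-≤ _ (𝟙≤1 (R? w))) (≤-reflexive (*-identityˡ _))) ⟩
  sum (λ w → sum λ i → 𝟙 (Q? w i))  ≡⟨ ∑-comm (λ w i → 𝟙 (Q? w i)) ⟩
  sum (λ i → sum λ w → 𝟙 (Q? w i))
    ≤⟨ sum-mono (λ i → sum-≤-single (λ w → 𝟙 (Q? w i)) _ (λ w → 𝟙-mono (Q? w i) (P? i) (Q⊆P w i))
         λ w w′ ne ne′ → disj w w′ i (𝟙≢0 (Q? w i) ne) (𝟙≢0 (Q? w′ i) ne′)) ⟩
  sum (λ i → 𝟙 (P? i))              ∎
  where open ≤-Reasoning

-- Enumerating decidable subsets

select : {P : Fin k → Set} (P? : Decidable P) → Fin (# P?) → Fin k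
select {suc k} P? i with P? zero
select {suc k} P? zero    | yes _ = zero
select {suc k} P? (suc i) | yes _ = suc (select (P? ∘ suc) i)
select {suc k} P? i       | no _  = suc (select (P? ∘ suc) i)

-- Inverse to `select`; the pair turns an equality of two counts into a bijection, as `Matching`
-- requires.
rank : {P : Fin k → Set} (P? : Decidable P) → ∀ i → P i → Fin (# P?)
rank {suc k} P? i p with P? zero
rank {suc k} P? zero    p | yes _ = zero
rank {suc k} P? (suc i) p | yes _ = suc (rank (P? ∘ suc) i p)
rank {suc k} P? zero    p | no ¬p = ⊥-elim (¬p p)
rank {suc k} P? (suc i) p | no _  = rank (P? ∘ suc) i p

select-∈ : {P : Fin k → Set} (P? : Decidable P) → ∀ i → P (select P? i)
select-∈ {suc k} P? i with P? zero
select-∈ {suc k} P? zero    | yes p = p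
select-∈ {suc k} P? (suc i) | yes _ = select-∈ (P? ∘ suc) i
select-∈ {suc k} P? i       | no _  = select-∈ (P? ∘ suc) i

select-rank : {P : Fin k → Set} (P? : Decidable P) → ∀ i p → select P? (rank P? i p) ≡ i
select-rank {suc k} P? i p with P? zero
select-rank {suc k} P? zero    p | yes _ = refl
select-rank {suc k} P? (suc i) p | yes _ = cong suc (select-rank (P? ∘ suc) i p)
select-rank {suc k} P? zero    p | no ¬p = ⊥-elim (¬p p)
select-rank {suc k} P? (suc i) p | no _  = cong suc (select-rank (P? ∘ suc) i p)

rank-select : {P : Fin k → Set} (P? : Decidable P) → ∀ i p → rank P? (select P? i) p ≡ i
rank-select {suc k} P? i p with P? zero
rank-select {suc k} P? zero    p | yes _ = refl
rank-select {suc k} P? (suc i) p | yes _ = cong suc (rank-select (P? ∘ suc) i p)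
rank-select {suc k} P? i       p | no _  = rank-select (P? ∘ suc) i p

-- Explorations of a tree

_∈?_ : (x : Fin k) (S : List (Fin k)) → Dec (x ∈ S)
_∈?_ = DecMembership._∈?_ _≟_

_∉?_ : (x : Fin k) (S : List (Fin k)) → Dec (x ∉ S)
_∉?_ = DecMembership._∉?_ _≟_

-- The measure of two inductions: over unexplored vertices in `explore`, and over edges outside `Y`
-- in `doubling`.
missing : List (Fin k) → ℕ
missing S = # λ x → x ∉? S

missing-∷ : (x : Fin k) (S : List (Fin k)) → x ∉ S → missing (x ∷ S) < missing S
missing-∷ x S x∉S = #-< (_∉? (x ∷ S)) (_∉? S) (λ _ y∉ y∈ → y∉ (there y∈)) x (λ x∉ → x∉ (here refl)) x∉S

Adj-sym : (G : Graph) {u v : V G} → Adj G u v → Adj G v u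
Adj-sym G {u} {v} h = trans (adj-sym G v u) h

Adj-irrefl : (G : Graph) {u v : V G} → Adj G u v → u ≢ v
Adj-irrefl G {u} h refl with () ← trans (sym h) (irref G u)

module _ (T : Graph) where

  data WalkIn (S : List (V T)) : V T → V T → Set where
    stay : ∀ {u} → u ∈ S → WalkIn S u u
    go   : ∀ {u w v} → u ∈ S → Adj T u w → WalkIn S w v → WalkIn S u v

  -- The vertices are listed in the index so that they can serve directly as the vertex sequence of
  -- a `Cycle`.
  data SimplePath (S : List (V T)) : ∀ {k} → V T → V T → Vec (V T) (suc k) → Set where
    point : ∀ {u} → u ∈ S → SimplePath S u u (u ∷ [])
    link  : ∀ {u w v k} {xs : Vec (V T) (suc k)} → u ∈ S → Adj T u w → SimplePath S w v xs →
            (∀ i → lookup xs i ≢ u) → SimplePath S u v (u ∷ xs)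

  module _ {S : List (V T)} where

    weaken : ∀ {x u v} → WalkIn S u v → WalkIn (x ∷ S) u v
    weaken (stay u∈)     = stay (there u∈)
    weaken (go u∈ h wlk) = go (there u∈) h (weaken wlk)

    snoc : ∀ {u v w} → WalkIn S u v → Adj T v w → w ∈ S → WalkIn S u w
    snoc (stay u∈)     h w∈ = go u∈ h (stay w∈)
    snoc (go u∈ e wlk) h w∈ = go u∈ e (snoc wlk h w∈)

    suffix : ∀ {u v k} {xs : Vec (V T) (suc k)} → SimplePath S u v xs → ∀ i →
      ∃ λ l → Σ (Vec (V T) (suc l)) λ ys → SimplePath S (lookup xs i) v ys
    suffix p@(point _)        zero    = _ , _ , p
    suffix p@(link _ _ _ _)   zero    = _ , _ , p
    suffix (link _ _ p _)     (suc i) = suffix p i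

    -- If the new first vertex recurs on the path already found, everything before that occurrence
    -- is dropped.
    loop-erase : ∀ {u v} → WalkIn S u v →
      ∃ λ l → Σ (Vec (V T) (suc l)) λ xs → SimplePath S u v xs
    loop-erase (stay u∈) = _ , _ , point u∈
    loop-erase {u} (go u∈ h wlk) with l , xs , p ← loop-erase wlk with any? (λ i → lookup xs i ≟ u)
    ... | yes (i , refl) = suffix p i
    ... | no u∉          = _ , _ , link u∈ h p λ i e → u∉ (i , e)

    path-start : ∀ {u v k} {xs : Vec (V T) (suc k)} → SimplePath S u v xs → lookup xs zero ≡ u
    path-start (point _)      = refl
    path-start (link _ _ _ _) = refl

    path-end : ∀ {u v k} {xs : Vec (V T) (suc k)} → SimplePath S u v xs → lookup xs (fromℕ k) ≡ v
    path-end (point _)      = refl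
    path-end (link _ _ p _) = path-end p

    path-∈ : ∀ {u v k} {xs : Vec (V T) (suc k)} → SimplePath S u v xs → ∀ i → lookup xs i ∈ S
    path-∈ (point u∈)      zero    = u∈
    path-∈ (link u∈ _ _ _) zero    = u∈
    path-∈ (link _ _ p _)  (suc i) = path-∈ p i

    path-adj : ∀ {u v k} {xs : Vec (V T) (suc k)} → SimplePath S u v xs →
      ∀ i → Adj T (lookup xs (inject₁ i)) (lookup xs (suc i))
    path-adj (link _ h p _) zero    = subst (Adj T _) (sym (path-start p)) h
    path-adj (link _ _ p _) (suc i) = path-adj p i

    path-injective : ∀ {u v k} {xs : Vec (V T) (suc k)} → SimplePath S u v xs →
      ∀ i j → lookup xs i ≡ lookup xs j → i ≡ j
    path-injective (point _)       zero    zero    e = refl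
    path-injective (link _ _ _ _)  zero    zero    e = refl
    path-injective (link _ _ _ u∉) zero    (suc j) e = ⊥-elim (u∉ j (sym e))
    path-injective (link _ _ _ u∉) (suc i) zero    e = ⊥-elim (u∉ i e)
    path-injective (link _ _ p _)  (suc i) (suc j) e = cong suc (path-injective p i j e)

    -- Putting `x` in front of the path closes it up. Since `u ≢ v` the path has at least two
    -- vertices, so the cycle has at least three.
    close-path : ∀ {u v x k} {xs : Vec (V T) (suc k)} → SimplePath S u v xs → u ≢ v →
      x ∉ S → Adj T x u → Adj T v x → Cycle T
    close-path (point _) u≢v _ _ _ = ⊥-elim (u≢v refl)
    close-path {x = x} {k = suc k} {xs} p@(link _ _ _ _) u≢v x∉ xu vx = record
      { k = suc (suc k) ; k≥2 = s≤s (s≤s z≤n) ; c = lookup (x ∷ xs)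
      ; c-inj = inj ; c-adj = adjacent
      ; c-close = subst (λ w → Adj T w x) (sym (path-end p)) vx }
      where
      inj : ∀ i j → lookup (x ∷ xs) i ≡ lookup (x ∷ xs) j → i ≡ j
      inj zero    zero    e = refl
      inj zero    (suc j) e = ⊥-elim (x∉ (subst (_∈ S) (sym e) (path-∈ p j)))
      inj (suc i) zero    e = ⊥-elim (x∉ (subst (_∈ S) e (path-∈ p i)))
      inj (suc i) (suc j) e = cong suc (path-injective p i j e)
      adjacent : ∀ i → Adj T (lookup (x ∷ xs) (inject₁ i)) (lookup (x ∷ xs) (suc i))
      adjacent zero    = xu
      adjacent (suc i) = path-adj p i

  -- Adds the vertices outside S one at a time, in at most k steps; uniqueness of the neighbour y
  -- of the new vertex x is where acyclicity enters.
  data Exploration : ℕ → List (V T) → Set where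
    done : ∀ {k S} → (∀ t → t ∈ S) → Exploration k S
    step : ∀ {k S} y x → y ∈ S → x ∉ S → Adj T y x → (∀ z → z ∈ S → Adj T z x → z ≡ y) →
           Exploration k (x ∷ S) → Exploration (suc k) S

  exit : ∀ {S u t} → Walk T u t → u ∈ S → t ∉ S → ∃₂ λ y x → y ∈ S × x ∉ S × Adj T y x
  exit nil u∈ t∉ = ⊥-elim (t∉ u∈)
  exit {S} (cons {u} {w} h wlk) u∈ t∉ with w ∈? S
  ... | yes w∈ = exit wlk w∈ t∉
  ... | no w∉  = u , w , u∈ , w∉ , h

  -- Any edge leaving `S` supplies the next vertex `x`. A second neighbour of `x` in `S` would be
  -- joined to `y` by a path inside `S`, which closes to a cycle through `x`; this is why
  -- connectivity within `S` is kept as an invariant.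
  explore : IsTree T → ∀ k S a → a ∈ S → (∀ {u v} → u ∈ S → v ∈ S → WalkIn S u v) →
    missing S ≤ k → Exploration k S
  explore tree@(_ , connected , acyclic) k S a a∈ conn few with any? (_∉? S)
  ... | no ¬∃ = done λ t → decide t
    where
    decide : ∀ t → t ∈ S
    decide t with t ∈? S
    ... | yes t∈ = t∈
    ... | no t∉  = ⊥-elim (¬∃ (t , t∉))
  ... | yes (t , t∉) with y , x , y∈ , x∉ , yx ← exit (connected a t) a∈ t∉ = grow k few
    where
    unique : ∀ z → z ∈ S → Adj T z x → z ≡ y
    unique z z∈ zx with z ≟ y
    ... | yes e = e
    ... | no z≢y with _ , _ , p ← loop-erase (conn z∈ y∈) =
      ⊥-elim (acyclic (close-path p z≢y x∉ (Adj-sym T zx) yx))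
    conn′ : ∀ {u v} → u ∈ (x ∷ S) → v ∈ (x ∷ S) → WalkIn (x ∷ S) u v
    conn′ (here refl) (here refl) = stay (here refl)
    conn′ (here refl) (there v∈)  = go (here refl) (Adj-sym T yx) (weaken (conn y∈ v∈))
    conn′ (there u∈)  (here refl) = snoc (weaken (conn u∈ y∈)) yx (here refl)
    conn′ (there u∈)  (there v∈)  = weaken (conn u∈ v∈)
    grow : ∀ k → missing S ≤ k → Exploration k S
    grow zero    few with () ← ≤-trans (missing-∷ x S x∉) few
    grow (suc k) few = step y x y∈ x∉ yx unique
      (explore tree k (x ∷ S) a (there a∈) conn′ (≤-pred (≤-trans (missing-∷ x S x∉) few)))

  -- The index `n T` later serves as the bound on the number of steps, both for the doublings and
  -- for the possible collisions.
  explore-edge : IsTree T → ∀ {a b} → Adj T a b → Exploration (n T) (a ∷ b ∷ [])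
  explore-edge tree {a} {b} ab = explore tree (n T) (a ∷ b ∷ []) a (here refl) conn (#-≤-size _)
    where
    conn : ∀ {u v} → u ∈ (a ∷ b ∷ []) → v ∈ (a ∷ b ∷ []) → WalkIn (a ∷ b ∷ []) u v
    conn (here refl)         (here refl)         = stay (here refl)
    conn (here refl)         (there (here refl)) = go (here refl) ab (stay (there (here refl)))
    conn (there (here refl)) (here refl)         = go (there (here refl)) (Adj-sym T ab) (stay (here refl))
    conn (there (here refl)) (there (here refl)) = stay (there (here refl))

  -- Each newly explored vertex inherits the value of the vertex it is attached to, so an edge with
  -- an end outside `S` never separates two values.
  extend-cut : ∀ {k S} → Exploration k S → (p : V T → Bool) →
    Σ (V T → Bool) λ q → (∀ s → s ∈ S → q s ≡ p s) ×
      (∀ a b → Adj T a b → q a ≡ q b ⊎ (a ∈ S × b ∈ S))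
  extend-cut (done all) p = p , (λ _ _ → refl) , λ a b _ → inj₂ (all a , all b)
  extend-cut {S = S} (step y x y∈ x∉ yx unique o) p
    with q , q≡ , cut ← extend-cut o (λ t → if does (t ≟ x) then p y else p t) =
    q , old , across
    where
    old : ∀ s → s ∈ S → q s ≡ p s
    old s s∈ with s ≟ x | q≡ s (there s∈)
    ... | yes refl | _ = ⊥-elim (x∉ s∈)
    ... | no _     | e = e
    new : q x ≡ p y
    new with x ≟ x | q≡ x (here refl)
    ... | yes _ | e = e
    ... | no ne | _ = ⊥-elim (ne refl)
    across : ∀ a b → Adj T a b → q a ≡ q b ⊎ (a ∈ S × b ∈ S)
    across a b ab with cut a b ab
    ... | inj₁ e                           = inj₁ e
    ... | inj₂ (there a∈ , there b∈)       = inj₂ (a∈ , b∈)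
    ... | inj₂ (here refl , here refl)     = ⊥-elim (Adj-irrefl T ab refl)
    ... | inj₂ (here refl , there b∈) with refl ← unique b b∈ (Adj-sym T ab) =
      inj₁ (trans new (sym (old b b∈)))
    ... | inj₂ (there a∈ , here refl) with refl ← unique a a∈ ab =
      inj₁ (trans (old a a∈) (sym new))

  -- The component of x in T minus the edge yx.
  record Branch (y x : V T) (S : List (V T)) : Set where
    field
      within  : V T → Bool
      root    : within x ≡ true
      outside : ∀ s → s ∈ S → within s ≡ false
      cut     : ∀ a b → Adj T a b → within a ≡ within b ⊎ (a ≡ y × b ≡ x) ⊎ (a ≡ x × b ≡ y)

  -- Spreads the indicator of `x` from `x ∷ S` to the whole tree. Only edges inside `x ∷ S` can
  -- still separate the two values, and `yx` is the only such edge at `x`.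
  branch : ∀ {k S y x} → x ∉ S → (∀ z → z ∈ S → Adj T z x → z ≡ y) →
    Exploration k (x ∷ S) → Branch y x S
  branch {S = S} {y} {x} x∉ unique o with q , q≡ , cut ← extend-cut o (λ t → does (t ≟ x)) = record
    { within = q ; root = root ; outside = outside ; cut = across }
    where
    root : q x ≡ true
    root with x ≟ x | q≡ x (here refl)
    ... | yes _ | e = e
    ... | no ne | _ = ⊥-elim (ne refl)
    outside : ∀ s → s ∈ S → q s ≡ false
    outside s s∈ with s ≟ x | q≡ s (there s∈)
    ... | yes refl | _ = ⊥-elim (x∉ s∈)
    ... | no _     | e = e
    across : ∀ a b → Adj T a b → q a ≡ q b ⊎ (a ≡ y × b ≡ x) ⊎ (a ≡ x × b ≡ y)
    across a b ab with cut a b ab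
    ... | inj₁ e                       = inj₁ e
    ... | inj₂ (there a∈ , there b∈)   = inj₁ (trans (outside a a∈) (sym (outside b b∈)))
    ... | inj₂ (here refl , here refl) = inj₁ refl
    ... | inj₂ (here refl , there b∈)  = inj₂ (inj₂ (refl , unique b b∈ (Adj-sym T ab)))
    ... | inj₂ (there a∈ , here refl)  = inj₂ (inj₁ (unique a a∈ ab , refl))

-- Switching

transpose-left : (i j : Fin k) → transpose i j i ≡ j
transpose-left i j with i ≟ i
... | yes _ = refl
... | no ne = ⊥-elim (ne refl)

transpose-right : (i j : Fin k) → transpose i j j ≡ i
transpose-right i j with j ≟ i
... | yes e = e
... | no _ with j ≟ j
...   | yes _ = refl
...   | no ne = ⊥-elim (ne refl)

transpose-other : (i j : Fin k) → ∀ {l} → l ≢ i → l ≢ j → transpose i j l ≡ l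
transpose-other i j {l} l≢i l≢j with l ≟ i
... | yes e = ⊥-elim (l≢i e)
... | no _ with l ≟ j
...   | yes e = ⊥-elim (l≢j e)
...   | no _  = refl

funToFin-cong : {f g : Fin k → Fin l} → (∀ i → f i ≡ g i) → funToFin f ≡ funToFin g
funToFin-cong {zero}  e = refl
funToFin-cong {suc k} e = cong₂ combine (e zero) (funToFin-cong (e ∘ suc))

finToFun-injective : ∀ l k (i j : Fin (l ^ k)) → (∀ t → finToFun {l} {k} i t ≡ finToFun {l} {k} j t) → i ≡ j
finToFun-injective l k i j e = trans (sym (funToFin-finToFin {k} {l} i))
  (trans (funToFin-cong e) (funToFin-finToFin {k} {l} j))

-- R a b u v says that uv is an edge of the host graph with colour ab whose ends u and v
-- play the roles of a and b.
record Pattern (T : Graph) (g D : ℕ) : Set₁ where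
  field
    R        : V T → V T → Fin g → Fin g → Set
    R?       : ∀ a b u v → Dec (R a b u v)
    R-adj    : ∀ {a b u v} → R a b u v → Adj T a b
    R-sym    : ∀ {a b u v} → R a b u v → R b a v u
    R-colour : ∀ {a b a′ b′ u v} → R a b u v → R a′ b′ u v → a ≡ a′ × b ≡ b′
    R-≢      : ∀ {a b u v} → R a b u v → u ≢ v
    -- The lower bound is asked only where `u` already plays `a` on some edge: a vertex on the wrong
    -- side has no edge in that role.
    R-degree : ∀ {a b b′ u v} → Adj T a b → R a b′ u v → D ≤ # (R? a b u)

-- Packings by homomorphic copies and their finite coding

module Packings {T : Graph} {g D : ℕ} (H : Pattern T g D) (N : ℕ) where
  open Pattern H

  Config : Set
  Config = Fin N → V T → Fin g

  -- The copies are labelled by `Fin N`. In `unique` two copies are compared at the same tree edge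
  -- only; this suffices because `R-colour` ties each ordered host pair to a single pair of roles.
  record IsPacking (f : Config) : Set where
    constructor packing
    field
      hom    : ∀ C a b → Adj T a b → R a b (f C a) (f C b)
      unique : ∀ C C′ a b → Adj T a b → f C a ≡ f C′ a → f C b ≡ f C′ b → C ≡ C′
      covers : ∀ a b u v → R a b u v → ∃ λ C → f C a ≡ u × f C b ≡ v
  open IsPacking

  opaque
    IsPacking? : ∀ f → Dec (IsPacking f)
    IsPacking? f with
      (all? λ C → all? λ a → all? λ b → (adj T a b Bool.≟ true) →-dec R? a b (f C a) (f C b)) ×-dec
      (all? λ C → all? λ C′ → all? λ a → all? λ b → (adj T a b Bool.≟ true) →-dec
        ((f C a ≟ f C′ a) →-dec ((f C b ≟ f C′ b) →-dec (C ≟ C′)))) ×-dec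
      (all? λ a → all? λ b → all? λ u → all? λ v → R? a b u v →-dec
        any? λ C → (f C a ≟ u) ×-dec (f C b ≟ v))
    ... | yes (h , u , c) = yes (packing h u c)
    ... | no ¬p           = no λ { (packing h u c) → ¬p (h , u , c) }

  Degenerate : (V T → Fin g) → Set
  Degenerate c = ∃₂ λ s t → s ≢ t × c s ≡ c t

  opaque
    Degenerate? : ∀ c → Dec (Degenerate c)
    Degenerate? c = any? λ s → any? λ t → ¬? (s ≟ t) ×-dec (c s ≟ c t)

  -- Host edges are coded as ordered pairs. Since `a` and `b` run over both orientations of a tree
  -- edge, either orientation in `Y` suffices.
  Meets : List (Fin (g * g)) → (V T → Fin g) → Set
  Meets Y c = ∃₂ λ a b → Adj T a b × combine (c a) (c b) ∈ Y

  opaque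
    Meets? : ∀ Y c → Dec (Meets Y c)
    Meets? Y c = any? λ a → any? λ b → (adj T a b Bool.≟ true) ×-dec (combine (c a) (c b) ∈? Y)

  -- Interpolates between nondegeneracy of every copy, when `Y` is empty, and a vacuous condition,
  -- when `Y` holds all pairs and `T` has an edge.
  Cleared : List (Fin (g * g)) → Config → Set
  Cleared Y f = ∀ C → Degenerate (f C) → Meets Y (f C)

  opaque
    Cleared? : ∀ Y f → Dec (Cleared Y f)
    Cleared? Y f = all? λ C → Degenerate? (f C) →-dec Meets? Y (f C)

  Cleared-mono : ∀ {Y Y′ f} → (∀ e → e ∈ Y → e ∈ Y′) → Cleared Y f → Cleared Y′ f
  Cleared-mono Y⊆ cl C deg with a , b , h , e ← cl C deg = a , b , h , Y⊆ _ e

  Agree : List (V T) → (h c : V T → Fin g) → Set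
  Agree S h c = ∀ s → s ∈ S → c s ≡ h s

  opaque
    Agree? : ∀ S h c → Dec (Agree S h c)
    Agree? S h c = all? λ s → (s ∈? S) →-dec (c s ≟ h s)

  degenerate-resp : ∀ {c c′ : V T → Fin g} → (∀ t → c t ≡ c′ t) → Degenerate c → Degenerate c′
  degenerate-resp e (s , t , s≢t , cs≡ct) = s , t , s≢t , trans (sym (e s)) (trans cs≡ct (e t))

  meets-resp : ∀ {Y} {c c′ : V T → Fin g} → (∀ t → c t ≡ c′ t) → Meets Y c → Meets Y c′
  meets-resp {Y} e (a , b , h , m) = a , b , h , subst (_∈ Y) (cong₂ combine (e a) (e b)) m

  packing-resp : ∀ {f f′} → (∀ C t → f C t ≡ f′ C t) → IsPacking f → IsPacking f′
  packing-resp e p = packing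
    (λ C a b ab → subst₂ (R a b) (e C a) (e C b) (hom p C a b ab))
    (λ C C′ a b ab ea eb → unique p C C′ a b ab
      (trans (e C a) (trans ea (sym (e C′ a)))) (trans (e C b) (trans eb (sym (e C′ b)))))
    λ a b u v r → let C , eu , ev = covers p a b u v r in
      C , trans (sym (e C a)) eu , trans (sym (e C b)) ev

  cleared-resp : ∀ {Y f f′} → (∀ C t → f C t ≡ f′ C t) → Cleared Y f → Cleared Y f′
  cleared-resp e cl C deg = meets-resp (e C) (cl C (degenerate-resp (λ t → sym (e C t)) deg))

  -- Coding configurations by numbers makes the probability space finite, so that probabilities
  -- become counts. Decoding inverts encoding only pointwise, hence the lemmas on pointwise equal
  -- configurations above.
  Codes : ℕ
  Codes = (g ^ n T) ^ N

  ⟦_⟧ : Fin Codes → Config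
  ⟦ ω ⟧ C = finToFun (finToFun ω C)

  encode : Config → Fin Codes
  encode f = funToFin λ C → funToFin (f C)

  decode-encode : ∀ f C t → ⟦ encode f ⟧ C t ≡ f C t
  decode-encode f C t = trans (cong (λ c → finToFun c t) (finToFun-funToFin (λ C → funToFin (f C)) C))
    (finToFun-funToFin (f C) t)

  decode-injective : ∀ ω ω′ → (∀ C t → ⟦ ω ⟧ C t ≡ ⟦ ω′ ⟧ C t) → ω ≡ ω′
  decode-injective ω ω′ e =
    finToFun-injective (g ^ n T) N ω ω′ λ C → finToFun-injective g (n T) _ _ (e C)

  Good : List (Fin (g * g)) → Fin Codes → Set
  Good Y ω = IsPacking ⟦ ω ⟧ × Cleared Y ⟦ ω ⟧

  opaque
    Good? : ∀ Y → Decidable (Good Y)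
    Good? Y ω = IsPacking? ⟦ ω ⟧ ×-dec Cleared? Y ⟦ ω ⟧

  Contains : List (Fin (g * g)) → List (V T) → (V T → Fin g) → Fin Codes → Set
  Contains Y S h ω = Good Y ω × ∃ λ C → Agree S h (⟦ ω ⟧ C)

  opaque
    Contains? : ∀ Y S h → Decidable (Contains Y S h)
    Contains? Y S h ω = Good? Y ω ×-dec any? λ C → Agree? S h (⟦ ω ⟧ C)

  ContainsBad : List (Fin (g * g)) → List (V T) → (V T → Fin g) → Fin Codes → Set
  ContainsBad Y S h ω = Good Y ω × ∃ λ C → Agree S h (⟦ ω ⟧ C) × Degenerate (⟦ ω ⟧ C)

  opaque
    ContainsBad? : ∀ Y S h → Decidable (ContainsBad Y S h)
    ContainsBad? Y S h ω = Good? Y ω ×-dec any? λ C → Agree? S h (⟦ ω ⟧ C) ×-dec Degenerate? (⟦ ω ⟧ C)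

  HasCopy : List (Fin (g * g)) → (V T → Fin g) → Fin Codes → Set
  HasCopy Y h ω = Good Y ω × ∃ λ C → ∀ t → ⟦ ω ⟧ C t ≡ h t

  opaque
    HasCopy? : ∀ Y h → Decidable (HasCopy Y h)
    HasCopy? Y h ω = Good? Y ω ×-dec any? λ C → all? λ t → ⟦ ω ⟧ C t ≟ h t

  _[_↦_] : (V T → Fin g) → V T → Fin g → V T → Fin g
  (h [ x ↦ w ]) t = if does (t ≟ x) then w else h t

  update-here : ∀ h x w → (h [ x ↦ w ]) x ≡ w
  update-here h x w with x ≟ x
  ... | yes _ = refl
  ... | no ne = ⊥-elim (ne refl)

  update-there : ∀ h {x} w {t} → t ≢ x → (h [ x ↦ w ]) t ≡ h t
  update-there h {x} w {t} ne with t ≟ x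
  ... | yes e = ⊥-elim (ne e)
  ... | no _  = refl

  ∉⇒≢ : ∀ {S : List (V T)} {x s} → x ∉ S → s ∈ S → s ≢ x
  ∉⇒≢ x∉ s∈ refl = x∉ s∈

  agree-update : ∀ {S h x w c} → x ∉ S → Agree S h c → c x ≡ w → Agree (x ∷ S) (h [ x ↦ w ]) c
  agree-update {h = h} {x} {w} x∉ ag e s (here refl) = trans e (sym (update-here h x w))
  agree-update {h = h} {x} {w} x∉ ag e s (there s∈)  =
    trans (ag s s∈) (sym (update-there h w (∉⇒≢ x∉ s∈)))

  agree-restrict : ∀ {S h x w c} → x ∉ S → Agree (x ∷ S) (h [ x ↦ w ]) c → Agree S h c
  agree-restrict {h = h} {x} {w} x∉ ag s s∈ =
    trans (ag s (there s∈)) (update-there h w (∉⇒≢ x∉ s∈))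

  turn : Bool → Fin N → Fin N → Fin N → Fin N
  turn true  i j C = transpose i j C
  turn false i j C = C

  turn-inverse : ∀ b i j C → turn b i j (turn b j i C) ≡ C
  turn-inverse true  i j C = transpose-inverse i j
  turn-inverse false i j C = refl

  switch : (V T → Bool) → Fin N → Fin N → Config → Config
  switch q i j f C t = f (turn (q t) i j C) t

  module _ (f : Config) {y x : V T} {S : List (V T)} (br : Branch T y x S) (y∈ : y ∈ S)
    (i j : Fin N) (same : f i y ≡ f j y) where
    open Branch br

    turn-y : ∀ b C → f (turn b i j C) y ≡ f C y
    turn-y false C = refl
    turn-y true  C with C ≟ i
    ... | yes refl = sym same
    ... | no C≢i with C ≟ j
    ...   | yes refl = same
    ...   | no C≢j   = refl

    -- Seen on a single tree edge, switching merely renumbers the copies. Only `yx` joins the two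
    -- sides of the cut, and there the swap is invisible at `y` because copies `i` and `j` agree at
    -- `y`.
    switch-edge : ∀ a b → Adj T a b → ∃ λ q → ∀ C →
      switch within i j f C a ≡ f (turn q i j C) a × switch within i j f C b ≡ f (turn q i j C) b
    switch-edge a b ab with cut a b ab
    ... | inj₁ e = within a , λ C → refl , cong (λ q → f (turn q i j C) b) (sym e)
    ... | inj₂ (inj₁ (refl , refl)) = within x , λ C →
      trans (turn-y (within y) C) (sym (turn-y (within x) C)) , refl
    ... | inj₂ (inj₂ (refl , refl)) = within x , λ C →
      refl , trans (turn-y (within y) C) (sym (turn-y (within x) C))

    switch-packing : IsPacking f → IsPacking (switch within i j f)
    switch-packing p = packing hom′ unique′ covers′
      where
      hom′ : ∀ C a b → Adj T a b → R a b (switch within i j f C a) (switch within i j f C b)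
      hom′ C a b ab with q , e ← switch-edge a b ab with ea , eb ← e C =
        subst₂ (R a b) (sym ea) (sym eb) (hom p _ a b ab)
      unique′ : ∀ C C′ a b → Adj T a b → switch within i j f C a ≡ switch within i j f C′ a →
        switch within i j f C b ≡ switch within i j f C′ b → C ≡ C′
      unique′ C C′ a b ab ea eb with q , e ← switch-edge a b ab =
        trans (sym (turn-inverse q j i C)) (trans (cong (turn q j i)
          (unique p _ _ a b ab (trans (sym (proj₁ (e C))) (trans ea (proj₁ (e C′))))
                               (trans (sym (proj₂ (e C))) (trans eb (proj₂ (e C′))))))
          (turn-inverse q j i C′))
      covers′ : ∀ a b u v → R a b u v → ∃ λ C →
        switch within i j f C a ≡ u × switch within i j f C b ≡ v
      covers′ a b u v r with q , e ← switch-edge a b (R-adj r) | C , eu , ev ← covers p a b u v r =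
        turn q j i C ,
        trans (proj₁ (e _)) (trans (cong (λ C → f C a) (turn-inverse q i j C)) eu) ,
        trans (proj₂ (e _)) (trans (cong (λ C → f C b) (turn-inverse q i j C)) ev)

    switch-other : ∀ C → C ≢ i → C ≢ j → ∀ t → switch within i j f C t ≡ f C t
    switch-other C C≢i C≢j t with within t
    ... | true  = cong (λ C → f C t) (transpose-other i j C≢i C≢j)
    ... | false = refl

    switch-outside : ∀ C s → s ∈ S → switch within i j f C s ≡ f C s
    switch-outside C s s∈ rewrite outside s s∈ = refl

    switch-i-x : switch within i j f i x ≡ f j x
    switch-i-x rewrite root = cong (λ C → f C x) (transpose-left i j)

    switch-j-x : switch within i j f j x ≡ f i x
    switch-j-x rewrite root = cong (λ C → f C x) (transpose-right i j)

  module _ {S : List (V T)} {y x a₀ b₀ : V T} (br : Branch T y x S) (y∈ : y ∈ S) (x∉ : x ∉ S)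
    (yx : Adj T y x) (a₀∈ : a₀ ∈ S) (b₀∈ : b₀ ∈ S) (ab₀ : Adj T a₀ b₀)
    (Y : List (Fin (g * g))) (h : V T → Fin g)
    (e₀∈Y : combine (h a₀) (h b₀) ∈ Y) (e∈Y : combine (h y) (h x) ∈ Y) where
    open Branch br

    module Switched (w : Fin g) (r : R y x (h y) w) (ω : Fin Codes) (c : Contains Y (x ∷ S) h ω) where
      f : Config
      f = ⟦ ω ⟧
      p : IsPacking f
      p = proj₁ (proj₁ c)
      i : Fin N
      i = proj₁ (proj₂ c)
      i-agrees : Agree (x ∷ S) h (f i)
      i-agrees = proj₂ (proj₂ c)
      j : Fin N
      j = proj₁ (covers p y x (h y) w r)
      j-y : f j y ≡ h y
      j-y = proj₁ (proj₂ (covers p y x (h y) w r))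
      j-x : f j x ≡ w
      j-x = proj₂ (proj₂ (covers p y x (h y) w r))
      same : f i y ≡ f j y
      same = trans (i-agrees y (there y∈)) (sym j-y)
      f′ : Config
      f′ = switch within i j f
      ω′ : Fin Codes
      ω′ = encode f′
      i-S : ∀ s → s ∈ S → f′ i s ≡ h s
      i-S s s∈ = trans (switch-outside f br y∈ i j same i s s∈) (i-agrees s (there s∈))
      j-y′ : f′ j y ≡ h y
      j-y′ = trans (switch-outside f br y∈ i j same j y y∈) j-y
      j-x′ : f′ j x ≡ h x
      j-x′ = trans (switch-j-x f br y∈ i j same) (i-agrees x (here refl))
      p′ : IsPacking f′
      p′ = switch-packing f br y∈ i j same p
      -- Only copies `i` and `j` change. Afterwards `i` still carries the image of `a₀b₀` and `j`
      -- carries the image of `yx` prescribed by `h`; both edges lie in `Y`, so both copies are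
      -- allowed to be degenerate.
      cleared′ : Cleared Y f′
      cleared′ C deg with C ≟ i
      ... | yes refl = a₀ , b₀ , ab₀ ,
        subst (_∈ Y) (sym (cong₂ combine (i-S a₀ a₀∈) (i-S b₀ b₀∈))) e₀∈Y
      ... | no C≢i with C ≟ j
      ...   | yes refl = y , x , yx , subst (_∈ Y) (sym (cong₂ combine j-y′ j-x′)) e∈Y
      ...   | no C≢j = meets-resp (λ t → sym (same-t t))
                (proj₂ (proj₁ c) C (degenerate-resp same-t deg))
        where
        same-t : ∀ t → f′ C t ≡ f C t
        same-t = switch-other f br y∈ i j same C C≢i C≢j
      sound : Contains Y (x ∷ S) (h [ x ↦ w ]) ω′
      sound =
        (packing-resp (λ C t → sym (decode-encode f′ C t)) p′ ,
         cleared-resp (λ C t → sym (decode-encode f′ C t)) cleared′) ,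
        i , agree-update x∉ (λ s s∈ → trans (decode-encode f′ i s) (i-S s s∈))
              (trans (decode-encode f′ i x) (trans (switch-i-x f br y∈ i j same) j-x))

    -- Swapping back undoes a switch, and the result reveals what to swap: `i` is the copy carrying
    -- the pair `h a₀`, `h b₀` at `a₀b₀`, and `j` the one carrying `h y`, `h x` at `yx`.
    switch-injective : ∀ w (r : R y x (h y) w) ω₁ ω₂ c₁ c₂ →
      Switched.ω′ w r ω₁ c₁ ≡ Switched.ω′ w r ω₂ c₂ → ω₁ ≡ ω₂
    switch-injective w r ω₁ ω₂ c₁ c₂ e = decode-injective ω₁ ω₂ λ C t →
      subst₂ (λ C₁ C₂ → ⟦ ω₁ ⟧ C₁ t ≡ ⟦ ω₂ ⟧ C₂ t)
        (turn-inverse (within t) A.i A.j C)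
        (trans (cong₂ (λ i j → turn (within t) i j (turn (within t) A.j A.i C)) (sym i≡) (sym j≡))
          (turn-inverse (within t) A.i A.j C))
        (f′≡ (turn (within t) A.j A.i C) t)
      where
      module A = Switched w r ω₁ c₁
      module B = Switched w r ω₂ c₂
      f′≡ : ∀ C t → A.f′ C t ≡ B.f′ C t
      f′≡ C t = trans (sym (decode-encode A.f′ C t))
        (trans (cong (λ ω → ⟦ ω ⟧ C t) e) (decode-encode B.f′ C t))
      i≡ : A.i ≡ B.i
      i≡ = unique A.p′ _ _ a₀ b₀ ab₀
        (trans (A.i-S a₀ a₀∈) (sym (trans (f′≡ B.i a₀) (B.i-S a₀ a₀∈))))
        (trans (A.i-S b₀ b₀∈) (sym (trans (f′≡ B.i b₀) (B.i-S b₀ b₀∈))))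
      j≡ : A.j ≡ B.j
      j≡ = unique A.p′ _ _ y x yx
        (trans A.j-y′ (sym (trans (f′≡ B.j y) B.j-y′)))
        (trans A.j-x′ (sym (trans (f′≡ B.j x) B.j-x′)))

    -- Switching the x-branches of two copies turns the copy extending h into one with w at x.
    switching : # (R? y x (h y)) * # (Contains? Y (x ∷ S) h) ≤ # (Contains? Y S h)
    switching = ≤-trans
      -- Every admissible image `w` of `x` receives an injective image of the left-hand family.
      -- Different `w` give disjoint families, since the copy through `a₀b₀` is unique and has one
      -- value at `x`.
      (∑-lower (R? y x (h y)) (λ w → # (Contains? Y (x ∷ S) (h [ x ↦ w ]))) _ λ w r →
        #-injection (Contains? Y (x ∷ S) h) (Contains? Y (x ∷ S) (h [ x ↦ w ]))
          (Switched.ω′ w r) (Switched.sound w r) (switch-injective w r))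
      (#-split-≥ (Contains? Y S h) (R? y x (h y)) (λ w → Contains? Y (x ∷ S) (h [ x ↦ w ]))
        (λ { w ω (good , C , ag) → good , C , agree-restrict x∉ ag })
        disjoint)
      where
      disjoint : ∀ w w′ ω → Contains Y (x ∷ S) (h [ x ↦ w ]) ω →
        Contains Y (x ∷ S) (h [ x ↦ w′ ]) ω → w ≡ w′
      disjoint w w′ ω ((p , _) , C , ag) (_ , C′ , ag′) =
        trans (sym (update-here h x w)) (trans (sym (ag x (here refl)))
          (trans (cong (λ C → ⟦ ω ⟧ C x) C≡C′) (trans (ag′ x (here refl)) (update-here h x w′))))
        where
        agS : ∀ s → s ∈ S → ⟦ ω ⟧ C s ≡ ⟦ ω ⟧ C′ s
        agS s s∈ = trans (agree-restrict x∉ ag s s∈) (sym (agree-restrict x∉ ag′ s s∈))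
        C≡C′ : C ≡ C′
        C≡C′ = unique p C C′ a₀ b₀ ab₀ (agS a₀ a₀∈) (agS b₀ b₀∈)

  -- Weights of explorations and the count of degenerate copies

  weight : ∀ {k S} → Exploration T k S → (V T → Fin g) → ℕ
  weight (done _)           h = 1
  weight (step y x _ _ _ _ o) h = # (R? y x (h y)) * weight o h

  steps : ∀ {k S} → Exploration T k S → (V T → Fin g) → List (Fin (g * g))
  steps (done _)             h = []
  steps (step y x _ _ _ _ o) h = combine (h y) (h x) ∷ steps o h

  length-steps : ∀ {k S} (o : Exploration T k S) h → length (steps o h) ≤ k
  length-steps (done _)             h = z≤n
  length-steps (step _ _ _ _ _ _ o) h = s≤s (length-steps o h)

  -- A random packing contains a prescribed copy h with probability at most 1 / weight, and this
  -- persists when only copies sharing no edge with h are required to be nondegenerate.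
  weight-bound : ∀ {k S} (o : Exploration T k S) {a₀ b₀} → a₀ ∈ S → b₀ ∈ S → Adj T a₀ b₀ →
    ∀ Y h → combine (h a₀) (h b₀) ∈ Y → (∀ e → e ∈ steps o h → e ∈ Y) →
    weight o h * # (HasCopy? Y h) ≤ # (Contains? Y S h)
  weight-bound {S = S} (done all) a₀∈ b₀∈ ab₀ Y h e₀ es = ≤-trans (≤-reflexive (*-identityˡ _))
    (#-mono (HasCopy? Y h) (Contains? Y S h) λ { ω (good , C , ag) → good , C , λ s _ → ag s })
  weight-bound {S = S} (step y x y∈ x∉ yx uniq o) a₀∈ b₀∈ ab₀ Y h e₀ es = begin
    d * weight o h * # (HasCopy? Y h)   ≡⟨ *-assoc d (weight o h) _ ⟩
    d * (weight o h * # (HasCopy? Y h)) ≤⟨ *-monoʳ-≤ d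
      (weight-bound o (there a₀∈) (there b₀∈) ab₀ Y h e₀ λ e e∈ → es e (there e∈)) ⟩
    d * # (Contains? Y (x ∷ S) h)
      ≤⟨ switching (branch T x∉ uniq o) y∈ x∉ yx a₀∈ b₀∈ ab₀ Y h e₀ (es _ (here refl)) ⟩
    # (Contains? Y S h)                 ∎
    where
    open ≤-Reasoning
    d = # (R? y x (h y))

  Extends : List (V T) → (h h′ : V T → Fin g) → Set
  Extends S h h′ = ∀ s → s ∈ S → h′ s ≡ h s

  Plays : V T → Fin g → Set
  Plays s u = ∃₂ λ b v → R s b u v

  InjectiveOn : List (V T) → (V T → Fin g) → Set
  InjectiveOn S h = ∀ s t → s ∈ S → t ∈ S → h s ≡ h t → s ≡ t

  module _ (Y : List (Fin (g * g))) (M : ℕ) where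

    -- `κ` collects the degrees of the steps already taken, so that `κ * weight o h′` remains the
    -- full weight of `h′` as the exploration advances.
    Bounded : ∀ {k S} → Exploration T k S → (V T → Fin g) → ℕ → Set
    Bounded {S = S} o h κ = ∀ h′ → Extends S h h′ → κ * (weight o h′ * # (HasCopy? Y h′)) ≤ M

    module _ {k S y x} (y∈ : y ∈ S) (x∉ : x ∉ S) (yx : Adj T y x)
      (uniq : ∀ z → z ∈ S → Adj T z x → z ≡ y) (o : Exploration T k (x ∷ S)) where

      bounded-step : ∀ h κ → Bounded (step y x y∈ x∉ yx uniq o) h κ →
        ∀ w → Bounded o (h [ x ↦ w ]) (κ * # (R? y x (h y)))
      bounded-step h κ bd w h′ ext = begin
        κ * d * (weight o h′ * B)   ≡⟨ scale-assoc κ d (weight o h′) B ⟩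
        κ * (d * weight o h′ * B)   ≡⟨ cong (λ z → κ * (# (R? y x z) * weight o h′ * B)) (sym (ext′ y y∈)) ⟩
        κ * (# (R? y x (h′ y)) * weight o h′ * B) ≤⟨ bd h′ ext′ ⟩
        M ∎
        where
        open ≤-Reasoning
        d = # (R? y x (h y))
        B = # (HasCopy? Y h′)
        ext′ : Extends S h h′
        ext′ = agree-restrict x∉ ext

      split-step : ∀ h → # (ContainsBad? Y S h) ≤
        ∑[ R? y x (h y) ] λ w → # (ContainsBad? Y (x ∷ S) (h [ x ↦ w ]))
      split-step h = #-split-≤ (ContainsBad? Y S h) (R? y x (h y))
        (λ w → ContainsBad? Y (x ∷ S) (h [ x ↦ w ]))
        λ { ω (good , C , ag , deg) → ⟦ ω ⟧ C x ,
            subst (λ u → R y x u (⟦ ω ⟧ C x)) (ag y y∈) (hom (proj₁ good) C y x yx) ,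
            good , C , agree-update x∉ ag refl , deg }

    scaled-∑ : ∀ {P : Fin g → Set} (P? : Decidable P) (F : Fin g → ℕ) κ {X} →
      X ≤ ∑[ P? ] F → # P? * (κ * X) ≤ ∑[ P? ] λ w → κ * # P? * F w
    scaled-∑ P? F κ {X} X≤ = begin
      # P? * (κ * X)        ≡⟨ trans (sym (*-assoc (# P?) κ X)) (cong (_* X) (*-comm (# P?) κ)) ⟩
      κ * # P? * X          ≤⟨ *-monoʳ-≤ (κ * # P?) X≤ ⟩
      κ * # P? * ∑[ P? ] F  ≡⟨ ∑-scale P? F (κ * # P?) ⟩
      ∑[ P? ] (λ w → κ * # P? * F w) ∎
      where open ≤-Reasoning

    -- The reciprocal weights of the completions of `h` sum to at most 1. To stay within natural
    -- numbers, each step multiplies by the degree `# P?`, bounds every summand by `M`, and cancels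
    -- the degree again.
    copies-bound : ∀ {k S} (o : Exploration T k S) h κ → Bounded o h κ →
      κ * # (ContainsBad? Y S h) ≤ M
    copies-bound {S = S} (done all) h κ bd = begin
      κ * # (ContainsBad? Y S h)   ≤⟨ *-monoʳ-≤ κ (#-mono (ContainsBad? Y S h) (HasCopy? Y h)
        λ { ω (good , C , ag , _) → good , C , λ t → ag t (all t) }) ⟩
      κ * # (HasCopy? Y h)         ≡⟨ cong (κ *_) (sym (*-identityˡ _)) ⟩
      κ * (1 * # (HasCopy? Y h))   ≤⟨ bd h (λ _ _ → refl) ⟩
      M                            ∎
      where open ≤-Reasoning
    copies-bound {S = S} (step y x y∈ x∉ yx uniq o) h κ bd = by-degree (# P?) refl
      where
      P? = R? y x (h y)
      F = λ w → # (ContainsBad? Y (x ∷ S) (h [ x ↦ w ]))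
      X≤ = split-step y∈ x∉ yx uniq o h
      each : ∀ w → R y x (h y) w → κ * # P? * F w ≤ M
      each w r = copies-bound o (h [ x ↦ w ]) (κ * # P?) (bounded-step y∈ x∉ yx uniq o h κ bd w)
      total : # P? * (κ * # (ContainsBad? Y S h)) ≤ # P? * M
      total = ≤-trans (scaled-∑ P? F κ X≤) (∑-upper P? (λ w → κ * # P? * F w) M each)
      empty : # P? ≡ 0 → # (ContainsBad? Y S h) ≡ 0
      empty d≡0 = #-zero (ContainsBad? Y S h) λ { ω (good , C , ag , _) →
        case-pos (subst (1 ≤_) d≡0 (#-positive P? (⟦ ω ⟧ C x)
          (subst (λ u → R y x u (⟦ ω ⟧ C x)) (ag y y∈) (hom (proj₁ good) C y x yx)))) }
        where
        case-pos : ¬ (1 ≤ 0)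
        case-pos ()
      by-degree : ∀ d → # P? ≡ d → κ * # (ContainsBad? Y S h) ≤ M
      -- Without an available image of `x` there is no degree to cancel, but then no packing
      -- contains a copy extending `h` either.
      by-degree zero d≡ = ≤-trans (≤-reflexive (trans (cong (κ *_) (empty d≡)) (*-zeroʳ κ))) z≤n
      by-degree (suc d) d≡ = *-cancelˡ-positive (# P?) (subst (1 ≤_) (sym d≡) (s≤s z≤n)) total

    -- Each new vertex must avoid at most n T of the at least D choices available to it.
    degenerate-bound : 1 ≤ D → ∀ {k S} (o : Exploration T k S) h κ → Bounded o h κ →
      (∀ s → s ∈ S → Plays s (h s)) → InjectiveOn S h →
      D * (κ * # (ContainsBad? Y S h)) ≤ k * (n T * M)
    degenerate-bound D≥1 {S = S} (done all) h κ bd plays inj =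
      ≤-trans (≤-reflexive (trans (cong (λ z → D * (κ * z)) none)
        (trans (cong (D *_) (*-zeroʳ κ)) (*-zeroʳ D)))) z≤n
      where
      none : # (ContainsBad? Y S h) ≡ 0
      none = #-zero (ContainsBad? Y S h) λ { ω (_ , C , ag , s , t , s≢t , e) →
        s≢t (inj s t (all s) (all t) (trans (sym (ag s (all s))) (trans e (ag t (all t))))) }
    degenerate-bound D≥1 {suc k} {S} (step y x y∈ x∉ yx uniq o) h κ bd plays inj =
      *-cancelˡ-positive (# P?) (≤-trans D≥1 D≤d) (begin
        # P? * (D * (κ * X))     ≡⟨ *-swap (# P?) D (κ * X) ⟩
        D * (# P? * (κ * X))     ≤⟨ *-monoʳ-≤ D (scaled-∑ P? F κ (split-step y∈ x∉ yx uniq o h)) ⟩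
        D * ∑[ P? ] (λ w → κ * # P? * F w)    ≡⟨ ∑-scale P? (λ w → κ * # P? * F w) D ⟩
        ∑[ P? ] (λ w → D * (κ * # P? * F w))  ≤⟨ sum-mono pointwise ⟩
        sum (λ w → 𝟙 (Clash? w) * (D * M) + 𝟙 (P? w) * (k * (n T * M)))
          ≡⟨ ∑-distrib-+ (λ w → 𝟙 (Clash? w) * (D * M)) (λ w → 𝟙 (P? w) * (k * (n T * M))) ⟩
        ∑[ Clash? ] (λ _ → D * M) + ∑[ P? ] (λ _ → k * (n T * M))
          ≤⟨ +-mono-≤ (∑-upper Clash? _ (D * M) (λ _ _ → ≤-refl)) (∑-upper P? _ (k * (n T * M)) (λ _ _ → ≤-refl)) ⟩
        # Clash? * (D * M) + # P? * (k * (n T * M))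
          -- At most `n T` values clash, and `D ≤ # P?` exchanges the factor `D` for one that can be
          -- cancelled.
          ≤⟨ +-mono-≤ (*-mono-≤ clashes (*-monoˡ-≤ M D≤d)) ≤-refl ⟩
        n T * (# P? * M) + # P? * (k * (n T * M))  ≡⟨ *-collect (n T) (# P?) M (k * (n T * M)) ⟩
        # P? * (suc k * (n T * M))           ∎)
      where
      open ≤-Reasoning
      P? = R? y x (h y)
      X = # (ContainsBad? Y S h)
      F = λ w → # (ContainsBad? Y (x ∷ S) (h [ x ↦ w ]))
      D≤d : D ≤ # P?
      -- The invariant `Plays` is kept for this: it provides the role of `h y` that the degree bound
      -- presupposes.
      D≤d = R-degree yx (proj₂ (proj₂ (plays y y∈)))
      Clash : Fin g → Set
      Clash w = ∃ λ s → s ∈ S × h s ≡ w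
      Clash? : Decidable Clash
      Clash? w = any? λ s → (s ∈? S) ×-dec (h s ≟ w)
      clashes : # Clash? ≤ n T
      clashes = ≤-trans (#-injection {Q = λ s → s ∈ S} Clash? (_∈? S) (λ _ → proj₁) (λ _ p → proj₁ (proj₂ p))
        λ { _ _ (s , _ , e) (_ , _ , e′) refl → trans (sym e) e′ }) (#-≤-size (_∈? S))
      bd′ : ∀ w → Bounded o (h [ x ↦ w ]) (κ * # P?)
      bd′ = bounded-step y∈ x∉ yx uniq o h κ bd
      -- A value `w` already taken by `h` on `S` is charged the crude bound from `copies-bound`. Any
      -- other `w` keeps the partial copy injective and passes to the induction with one step fewer.
      pointwise : ∀ w → 𝟙 (P? w) * (D * (κ * # P? * F w)) ≤
        𝟙 (Clash? w) * (D * M) + 𝟙 (P? w) * (k * (n T * M))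
      pointwise w with P? w
      ... | no _ = z≤n
      ... | yes r with Clash? w
      ...   | yes _ = ≤-trans (*-monoʳ-≤ 1 (*-monoʳ-≤ D (copies-bound o _ (κ * # P?) (bd′ w)))) (m≤m+n _ _)
      ...   | no ¬clash = *-monoʳ-≤ 1 (degenerate-bound D≥1 o (h [ x ↦ w ]) (κ * # P?) (bd′ w) plays′ inj′)
        where
        plays′ : ∀ s → s ∈ (x ∷ S) → Plays s ((h [ x ↦ w ]) s)
        plays′ s (here refl) = y , h y , subst (λ u → R s y u (h y)) (sym (update-here h x w)) (R-sym r)
        plays′ s (there s∈)  = subst (Plays s) (sym (update-there h w (∉⇒≢ x∉ s∈))) (plays s s∈)
        inj′ : InjectiveOn (x ∷ S) (h [ x ↦ w ])
        inj′ s t (here refl) (here refl) e = refl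
        inj′ s t (here refl) (there t∈)  e = ⊥-elim (¬clash (t , t∈ ,
          trans (sym (update-there h w (∉⇒≢ x∉ t∈))) (trans (sym e) (update-here h x w))))
        inj′ s t (there s∈) (here refl)  e = ⊥-elim (¬clash (s , s∈ ,
          trans (sym (update-there h w (∉⇒≢ x∉ s∈))) (trans e (update-here h x w))))
        inj′ s t (there s∈) (there t∈)   e = inj s t s∈ t∈
          (trans (sym (update-there h w (∉⇒≢ x∉ s∈))) (trans e (update-there h w (∉⇒≢ x∉ t∈))))

  -- The local lemma

  module LocalLemma (tree : IsTree T) (large : 2 * (n T * (n T * 2 ^ n T)) ≤ D) where

    private
      D≥1 : 1 ≤ D
      D≥1 = ≤-trans (*-mono-≤ {1} {2} (s≤s z≤n) (*-mono-≤ (proj₁ tree) (*-mono-≤ (proj₁ tree) (m^n>0 2 (n T))))) large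

      c≥1 : 1 ≤ n T * (n T * 2 ^ n T)
      c≥1 = *-mono-≤ (proj₁ tree) (*-mono-≤ (proj₁ tree) (m^n>0 2 (n T)))

    -- A small `k` means a large `Y`: the induction starts where no edge is missing and removes
    -- edges from `Y` one by one.
    Doubling : ℕ → Set
    Doubling k = ∀ Y → missing Y ≤ k → ∀ e → # (Good? (e ∷ Y)) ≤ 2 * # (Good? Y)

    good-⊆ : ∀ {Y Y′} → (∀ e → e ∈ Y → e ∈ Y′) → # (Good? Y) ≤ # (Good? Y′)
    good-⊆ {Y} {Y′} sub = #-mono (Good? Y) (Good? Y′) λ { ω (p , cl) → p , Cleared-mono sub cl }

    missing-++ : ∀ (L : List (Fin (g * g))) Y → missing (L ++ Y) ≤ missing Y
    missing-++ L Y = #-mono (_∉? (L ++ Y)) (_∉? Y) λ _ e∉ e∈ → e∉ (∈-++⁺ʳ L e∈)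

    doubling-++ : Doubling k → ∀ Y → missing Y ≤ k → ∀ L →
      # (Good? (L ++ Y)) ≤ 2 ^ length L * # (Good? Y)
    doubling-++ dbl Y few []      = ≤-reflexive (sym (*-identityˡ _))
    doubling-++ dbl Y few (e ∷ L) = begin
      # (Good? (e ∷ (L ++ Y)))         ≤⟨ dbl (L ++ Y) (≤-trans (missing-++ L Y) few) e ⟩
      2 * # (Good? (L ++ Y))           ≤⟨ *-monoʳ-≤ 2 (doubling-++ dbl Y few L) ⟩
      2 * (2 ^ length L * # (Good? Y)) ≡⟨ sym (*-assoc 2 (2 ^ length L) _) ⟩
      2 ^ length (e ∷ L) * # (Good? Y) ∎
      where open ≤-Reasoning

    module _ {k} (dbl : Doubling k) (Y : List (Fin (g * g))) {a b : V T} {u v : Fin g}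
      (r : R a b u v) (few : missing (combine u v ∷ Y) ≤ k) where

      private
        Y⁺ : List (Fin (g * g))
        Y⁺ = combine u v ∷ Y
        A : ℕ
        A = # (Good? Y⁺)
        S₀ : List (V T)
        S₀ = a ∷ b ∷ []
        M : ℕ
        M = 2 ^ n T * A

        h₀ : V T → Fin g
        h₀ t = if does (t ≟ a) then u else v

        h₀-a : h₀ a ≡ u
        h₀-a with a ≟ a
        ... | yes _ = refl
        ... | no ne = ⊥-elim (ne refl)

        h₀-b : h₀ b ≡ v
        h₀-b with b ≟ a
        ... | yes e = ⊥-elim (Adj-irrefl T (R-adj r) (sym e))
        ... | no _  = refl

        o : Exploration T (n T) S₀
        o = explore-edge T tree (R-adj r)

        -- Joining the edges of `h` to `Y⁺` makes `weight-bound` applicable. By `dbl` each joined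
        -- edge at most doubles the number of good packings, and there are at most `n T` of them.
        bounded : Bounded Y⁺ M o h₀ 1
        bounded h ext = begin
          1 * (weight o h * # (HasCopy? Y⁺ h))  ≡⟨ *-identityˡ _ ⟩
          weight o h * # (HasCopy? Y⁺ h)        ≤⟨ *-monoʳ-≤ (weight o h)
            (#-mono (HasCopy? Y⁺ h) (HasCopy? (steps o h ++ Y⁺) h)
              λ { ω ((p , cl) , copy) → (p , Cleared-mono (λ _ → ∈-++⁺ʳ (steps o h)) cl) , copy }) ⟩
          weight o h * # (HasCopy? (steps o h ++ Y⁺) h)
            ≤⟨ weight-bound o (here refl) (there (here refl)) (R-adj r) (steps o h ++ Y⁺) h
                 (∈-++⁺ʳ (steps o h) (here (cong₂ combine (trans (ext a (here refl)) h₀-a)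
                   (trans (ext b (there (here refl))) h₀-b))))
                 (λ _ → ∈-++⁺ˡ) ⟩
          # (Contains? (steps o h ++ Y⁺) S₀ h)  ≤⟨ #-mono (Contains? (steps o h ++ Y⁺) S₀ h)
            (Good? (steps o h ++ Y⁺)) (λ _ → proj₁) ⟩
          # (Good? (steps o h ++ Y⁺))           ≤⟨ doubling-++ dbl Y⁺ few (steps o h) ⟩
          2 ^ length (steps o h) * A            ≤⟨ *-monoˡ-≤ A (^-monoʳ-≤ 2 (length-steps o h)) ⟩
          M                                     ∎
          where open ≤-Reasoning

        plays : ∀ s → s ∈ S₀ → Plays s (h₀ s)
        plays s (here refl)         = b , v , subst (λ z → R a b z v) (sym h₀-a) r
        plays s (there (here refl)) = a , u , subst (λ z → R b a z u) (sym h₀-b) (R-sym r)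

        h₀-injective : InjectiveOn S₀ h₀
        h₀-injective s t (here refl)         (here refl)         e = refl
        h₀-injective s t (here refl)         (there (here refl)) e =
          ⊥-elim (R-≢ r (trans (sym h₀-a) (trans e h₀-b)))
        h₀-injective s t (there (here refl)) (here refl)         e =
          ⊥-elim (R-≢ r (trans (sym h₀-a) (trans (sym e) h₀-b)))
        h₀-injective s t (there (here refl)) (there (here refl)) e = refl

        X : ℕ
        X = # (ContainsBad? Y⁺ S₀ h₀)

        -- With `c = n T * (n T * 2 ^ n T)`, the size of `D` and `degenerate-bound` give
        -- `2 * c * X ≤ D * X ≤ c * A`, and `c` cancels.
        half : 2 * X ≤ A
        half = *-cancelˡ-positive c c≥1 (begin
          c * (2 * X)                   ≡⟨ double-assoc c X ⟩
          2 * c * X                     ≤⟨ *-monoˡ-≤ X large ⟩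
          D * X                         ≡⟨ cong (D *_) (sym (*-identityˡ X)) ⟩
          D * (1 * X)                   ≤⟨ degenerate-bound Y⁺ M D≥1 o h₀ 1 bounded plays h₀-injective ⟩
          n T * (n T * (2 ^ n T * A))   ≡⟨ *-regroup (n T) (2 ^ n T) A ⟩
          c * A                         ∎)
          where
          open ≤-Reasoning
          c = n T * (n T * 2 ^ n T)

        -- A packing that is good for `Y⁺` but not for `Y` has a degenerate copy meeting `Y⁺` only
        -- at `uv`. By `R-colour` that copy carries `uv` as the image of `ab`, so it agrees with
        -- `h₀`.
        split : A ≤ # (Good? Y) + X
        split = #-cover (Good? Y⁺) (Good? Y) (ContainsBad? Y⁺ S₀ h₀) cover
          where
          cover : ∀ ω → Good Y⁺ ω → Good Y ω ⊎ ContainsBad Y⁺ S₀ h₀ ω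
          cover ω good@(p , cl) with any? (λ C → Degenerate? (⟦ ω ⟧ C) ×-dec ¬? (Meets? Y (⟦ ω ⟧ C)))
          ... | no all-good = inj₁ (p , clear)
            where
            clear : Cleared Y ⟦ ω ⟧
            clear C deg with Meets? Y (⟦ ω ⟧ C)
            ... | yes m = m
            ... | no ¬m = ⊥-elim (all-good (C , deg , ¬m))
          ... | yes (C , deg , ¬m) with cl C deg
          ...   | a′ , b′ , ab′ , there m = ⊥-elim (¬m (a′ , b′ , ab′ , m))
          ...   | a′ , b′ , ab′ , here m with combine-injective _ _ _ _ m
          ...     | eu , ev with R-colour (subst₂ (R a′ b′) eu ev (hom p C a′ b′ ab′)) r
          ...       | refl , refl = inj₂ (good , C , agree , deg)
            where
            agree : Agree S₀ h₀ (⟦ ω ⟧ C)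
            agree s (here refl)         = trans eu (sym h₀-a)
            agree s (there (here refl)) = trans ev (sym h₀-b)

      double : # (Good? (combine u v ∷ Y)) ≤ 2 * # (Good? Y)
      -- Adding the splitting inequality to itself allows `2 * X ≤ A` to be used without division.
      double = +-cancelʳ-≤ A A (2 * G) (begin
        A + A             ≤⟨ +-mono-≤ split split ⟩
        (G + X) + (G + X) ≡⟨ +-twice G X ⟩
        2 * G + 2 * X     ≤⟨ +-monoʳ-≤ (2 * G) half ⟩
        2 * G + A         ∎)
        where
        open ≤-Reasoning
        G = # (Good? Y)

    doubling : ∀ k → Doubling k
    doubling k Y few e with e ∈? Y
    ... | yes e∈ = ≤-trans (good-⊆ λ { _ (here refl) → e∈ ; _ (there z) → z }) (m≤m+n _ _)
    ... | no e∉ with u , v , refl ← combine-surjective {g} {g} e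
                 with any? (λ a → any? λ b → R? a b u v)
    -- A pair without a role is no edge of any copy, so adding it to `Y` excuses no degenerate copy.
    ...   | no colourless = ≤-trans (#-mono (Good? (combine u v ∷ Y)) (Good? Y) drop) (m≤m+n _ _)
      where
      drop : ∀ ω → Good (combine u v ∷ Y) ω → Good Y ω
      drop ω (p , cl) = p , λ C deg → avoid C (cl C deg)
        where
        avoid : ∀ C → Meets (combine u v ∷ Y) (⟦ ω ⟧ C) → Meets Y (⟦ ω ⟧ C)
        avoid C (a , b , ab , there m) = a , b , ab , m
        avoid C (a , b , ab , here m) with eu , ev ← combine-injective _ _ _ _ m =
          ⊥-elim (colourless (a , b , subst₂ (R a b) eu ev (hom p C a b ab)))
    ...   | yes (a , b , r) = coloured k few
      where
      coloured : ∀ k → missing Y ≤ k → # (Good? (combine u v ∷ Y)) ≤ 2 * # (Good? Y)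
      -- Since `e` lies outside `Y`, at least one pair is missing, which excludes this case.
      coloured zero    few with () ← ≤-trans (missing-∷ _ Y e∉) few
      coloured (suc k) few = double (doubling k) Y r (≤-pred (≤-trans (missing-∷ _ Y e∉) few))

    -- When `Y` contains all pairs, every packing is good. Passing from there to empty `Y` loses at
    -- most a factor 2 per pair, so the count cannot drop to zero.
    nondegenerate-packing : ∀ {a b} → Adj T a b → ∀ f → IsPacking f →
      ∃ λ f′ → IsPacking f′ × ∀ C → ¬ Degenerate (f′ C)
    nondegenerate-packing {a} {b} ab f p with # (Good? []) in eq
    ... | zero = ⊥-elim (1≰0 (subst (1 ≤_) none some))
      where
      1≰0 : ¬ (1 ≤ 0)
      1≰0 ()
      all = allFin (g * g) ++ []
      some : 1 ≤ # (Good? all)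
      some = #-positive (Good? all) (encode f)
        (packing-resp (λ C t → sym (decode-encode f C t)) p ,
         -- Every copy, degenerate or not, meets the full list at its image of `ab`.
         λ C _ → a , b , ab , ∈-++⁺ˡ (∈-allFin _))
      none : # (Good? all) ≡ 0
      none = ≤-antisym (≤-trans (doubling-++ (doubling _) [] ≤-refl (allFin (g * g)))
        (≤-reflexive (trans (cong (2 ^ length (allFin (g * g)) *_) eq) (*-zeroʳ (2 ^ length (allFin (g * g))))))) z≤n
    ... | suc _ with ω , p′ , cl ← #-witness (Good? []) (subst (1 ≤_) (sym eq) (s≤s z≤n)) =
      ⟦ ω ⟧ , p′ , λ C deg → meets-nothing (cl C deg)
      where
      meets-nothing : ∀ {c} → ¬ Meets [] c
      meets-nothing (_ , _ , _ , ())

-- A first splitting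

rank-injective : {P : Fin k → Set} (P? : Decidable P) → ∀ i j p q →
  rank P? i p ≡ rank P? j q → i ≡ j
rank-injective P? i j p q e =
  trans (sym (select-rank P? i p)) (trans (cong (select P?) e) (select-rank P? j q))

select-injective : {P : Fin k → Set} (P? : Decidable P) → ∀ i j → select P? i ≡ select P? j → i ≡ j
select-injective P? i j e = trans (sym (rank-select P? i (select-∈ P? i))) (rank-at _ _ e)
  where
  rank-at : ∀ a p → a ≡ select P? j → rank P? a p ≡ j
  rank-at a p refl = rank-select P? j p

-- For each `u` separately, the copies placing a vertex at `u` are matched in order with the members
-- of `Q u`; equality of the sizes makes this a bijection.
module Matching {N g : ℕ} (f : Fin N → Fin g) {Q : Fin g → Fin g → Set}
  (Q? : ∀ u → Decidable (Q u)) (same-size : ∀ u → # (λ C → f C ≟ u) ≡ # (Q? u)) where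

  private
    fibre? : ∀ u → Decidable (λ C → f C ≡ u)
    fibre? u C = f C ≟ u

    -- Stated for any `u` with a proof of `f C ≡ u`, so that two copies with equal values can be
    -- ranked in one common fibre.
    partner′ : ∀ u C → f C ≡ u → Fin g
    partner′ u C p = select (Q? u) (subst Fin (same-size u) (rank (fibre? u) C p))

  partner : Fin N → Fin g
  partner C = partner′ (f C) C refl

  private
    partner≡ : ∀ u C (p : f C ≡ u) → partner C ≡ partner′ u C p
    partner≡ u C refl = refl

  partner-∈ : ∀ C → Q (f C) (partner C)
  partner-∈ C = select-∈ (Q? (f C)) _

  partner-injective : ∀ C C′ → f C ≡ f C′ → partner C ≡ partner C′ → C ≡ C′
  partner-injective C C′ e e′ = rank-injective (fibre? (f C′)) C C′ e refl
    (subst-injective (same-size (f C′)) (select-injective (Q? (f C′)) _ _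
      (trans (sym (partner≡ (f C′) C e)) e′)))

  partner-surjective : ∀ u v → Q u v → ∃ λ C → f C ≡ u × partner C ≡ v
  partner-surjective u v q = C , p , (begin
    partner C                              ≡⟨ partner≡ u C p ⟩
    select (Q? u) (subst Fin (same-size u) (rank (fibre? u) C p))
      ≡⟨ cong (λ i → select (Q? u) (subst Fin (same-size u) i)) (rank-select (fibre? u) j p) ⟩
    select (Q? u) (subst Fin (same-size u) j)   ≡⟨ cong (select (Q? u)) (subst-subst-sym (same-size u)) ⟩
    select (Q? u) (rank (Q? u) v q)             ≡⟨ select-rank (Q? u) v q ⟩
    v                                           ∎)
    where
    open ≡-Reasoning
    j = subst Fin (sym (same-size u)) (rank (Q? u) v q)
    C = select (fibre? u) j
    p = select-∈ (fibre? u) j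

module Initial {T : Graph} {g D : ℕ} (H : Pattern T g D) (tree : IsTree T) where
  open Pattern H

  Equalized : Set
  Equalized = ∀ y x x′ u → Adj T y x → Adj T y x′ → # (R? y x u) ≡ # (R? y x′ u)

  -- `neighbour` gives each explored vertex an edge inside `S`, from which `fibre-size` reads off
  -- how many copies pass through a given host vertex there.
  record PartialPacking (N : ℕ) (S : List (V T)) (f : Fin N → V T → Fin g) : Set where
    field
      hom      : ∀ C a b → a ∈ S → b ∈ S → Adj T a b → R a b (f C a) (f C b)
      unique   : ∀ C C′ a b → a ∈ S → b ∈ S → Adj T a b → f C a ≡ f C′ a → f C b ≡ f C′ b → C ≡ C′
      covers   : ∀ a b u v → a ∈ S → b ∈ S → R a b u v → ∃ λ C → f C a ≡ u × f C b ≡ v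
      neighbour : ∀ s → s ∈ S → ∃ λ t → t ∈ S × Adj T s t
  open PartialPacking

  -- Each host edge at `u` in the role `yx` lies in exactly one copy, so sending a copy to its value
  -- at `x` is a bijection.
  fibre-size : ∀ {N S f y x} → PartialPacking N S f → y ∈ S → x ∈ S → Adj T y x → ∀ u →
    # (λ C → f C y ≟ u) ≡ # (R? y x u)
  fibre-size {N} {S} {f} {y} {x} p y∈ x∈ yx u = ≤-antisym
    (#-injection (λ C → f C y ≟ u) (R? y x u) (λ C _ → f C x)
      (λ { C refl → hom p C y x y∈ x∈ yx })
      (λ C C′ e e′ → unique p C C′ y x y∈ x∈ yx (trans e (sym e′))))
    (#-injection (R? y x u) (λ C → f C y ≟ u) (λ w r → proj₁ (cov w r)) (λ w r → proj₁ (proj₂ (cov w r)))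
      λ w w′ r r′ e → trans (sym (proj₂ (proj₂ (cov w r))))
        (trans (cong (λ C → f C x) e) (proj₂ (proj₂ (cov w′ r′)))))
    where
    cov : ∀ w → R y x u w → ∃ λ C → f C y ≡ u × f C x ≡ w
    cov w r = covers p y x u w y∈ x∈ r

  module Extend {N S f y x} (p : PartialPacking N S f) (y∈ : y ∈ S) (x∉ : x ∉ S)
    (yx : Adj T y x) (uniq : ∀ z → z ∈ S → Adj T z x → z ≡ y) (partner : Fin N → Fin g)
    (partner-∈ : ∀ C → R y x (f C y) (partner C))
    (partner-injective : ∀ C C′ → f C y ≡ f C′ y → partner C ≡ partner C′ → C ≡ C′)
    (partner-surjective : ∀ u v → R y x u v → ∃ λ C → f C y ≡ u × partner C ≡ v) where

    f′ : Fin N → V T → Fin g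
    f′ C t = if does (t ≟ x) then partner C else f C t

    new : ∀ C → f′ C x ≡ partner C
    new C with x ≟ x
    ... | yes _ = refl
    ... | no ne = ⊥-elim (ne refl)

    old : ∀ C {s} → s ∈ S → f′ C s ≡ f C s
    old C {s} s∈ with s ≟ x
    ... | yes refl = ⊥-elim (x∉ s∈)
    ... | no _     = refl

    extended : PartialPacking N (x ∷ S) f′
    extended = record { hom = hom′ ; unique = unique′ ; covers = covers′ ; neighbour = neighbour′ }
      where
      R-new : ∀ C → R y x (f′ C y) (f′ C x)
      R-new C = subst₂ (R y x) (sym (old C y∈)) (sym (new C)) (partner-∈ C)
      unique-new : ∀ C C′ → f′ C y ≡ f′ C′ y → f′ C x ≡ f′ C′ x → C ≡ C′
      unique-new C C′ e e′ = partner-injective C C′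
        (trans (sym (old C y∈)) (trans e (old C′ y∈))) (trans (sym (new C)) (trans e′ (new C′)))
      covers-new : ∀ u v → R y x u v → ∃ λ C → f′ C y ≡ u × f′ C x ≡ v
      covers-new u v r = let C , eu , ev = partner-surjective u v r in
        C , trans (old C y∈) eu , trans (new C) ev
      hom-new : ∀ C {a} → a ≡ y → R a x (f′ C a) (f′ C x)
      hom-new C refl = R-new C
      hom′ : ∀ C a b → a ∈ (x ∷ S) → b ∈ (x ∷ S) → Adj T a b → R a b (f′ C a) (f′ C b)
      hom′ C a b (here refl) (here refl) ab = ⊥-elim (Adj-irrefl T ab refl)
      hom′ C a b (here refl) (there b∈)  ab = R-sym (hom-new C (uniq b b∈ (Adj-sym T ab)))
      hom′ C a b (there a∈)  (here refl) ab = hom-new C (uniq a a∈ ab)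
      hom′ C a b (there a∈)  (there b∈)  ab =
        subst₂ (R a b) (sym (old C a∈)) (sym (old C b∈)) (hom p C a b a∈ b∈ ab)
      unique-at : ∀ C C′ {a} → a ≡ y → f′ C a ≡ f′ C′ a → f′ C x ≡ f′ C′ x → C ≡ C′
      unique-at C C′ refl = unique-new C C′
      unique′ : ∀ C C′ a b → a ∈ (x ∷ S) → b ∈ (x ∷ S) → Adj T a b →
        f′ C a ≡ f′ C′ a → f′ C b ≡ f′ C′ b → C ≡ C′
      unique′ C C′ a b (here refl) (here refl) ab ea eb = ⊥-elim (Adj-irrefl T ab refl)
      unique′ C C′ a b (here refl) (there b∈)  ab ea eb = unique-at C C′ (uniq b b∈ (Adj-sym T ab)) eb ea
      unique′ C C′ a b (there a∈)  (here refl) ab ea eb = unique-at C C′ (uniq a a∈ ab) ea eb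
      unique′ C C′ a b (there a∈)  (there b∈)  ab ea eb = unique p C C′ a b a∈ b∈ ab
        (trans (sym (old C a∈)) (trans ea (old C′ a∈))) (trans (sym (old C b∈)) (trans eb (old C′ b∈)))
      covers-at : ∀ {a} u v → a ≡ y → R a x u v → ∃ λ C → f′ C a ≡ u × f′ C x ≡ v
      covers-at u v refl = covers-new u v
      covers′ : ∀ a b u v → a ∈ (x ∷ S) → b ∈ (x ∷ S) → R a b u v → ∃ λ C → f′ C a ≡ u × f′ C b ≡ v
      covers′ a b u v (here refl) (here refl) r = ⊥-elim (Adj-irrefl T (R-adj r) refl)
      covers′ a b u v (here refl) (there b∈)  r =
        let C , ev , eu = covers-at v u (uniq b b∈ (Adj-sym T (R-adj r))) (R-sym r) in C , eu , ev
      covers′ a b u v (there a∈)  (here refl) r = covers-at u v (uniq a a∈ (R-adj r)) r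
      covers′ a b u v (there a∈)  (there b∈)  r = let C , eu , ev = covers p a b u v a∈ b∈ r in
        C , trans (old C a∈) eu , trans (old C b∈) ev
      neighbour′ : ∀ s → s ∈ (x ∷ S) → ∃ λ t → t ∈ (x ∷ S) × Adj T s t
      neighbour′ s (here refl) = y , there y∈ , Adj-sym T yx
      neighbour′ s (there s∈) with t , t∈ , st ← neighbour p s s∈ = t , there t∈ , st

  complete : Equalized → ∀ {k N S f} → Exploration T k S → PartialPacking N S f →
    ∃ (Packings.IsPacking H N)
  complete eqz {N = N} {f = f} (done all) p = f , Packings.packing
    (λ C a b → hom p C a b (all a) (all b))
    (λ C C′ a b → unique p C C′ a b (all a) (all b))
    (λ a b u v → covers p a b u v (all a) (all b))
  complete eqz {N = N} {S = S} {f = f} (step y x y∈ x∉ yx uniq o) p = complete eqz o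
    (Extend.extended p y∈ x∉ yx uniq M.partner M.partner-∈ M.partner-injective M.partner-surjective)
    where
    sizes : ∀ u → # (λ C → f C y ≟ u) ≡ # (R? y x u)
    -- The copies through `u` at `y` are counted by the old edge `yt`; equitability transfers the
    -- count to the new edge `yx`.
    sizes u with t , t∈ , yt ← neighbour p y y∈ =
      trans (fibre-size p y∈ t∈ yt u) (eqz y t x u yt yx)
    module M = Matching (λ C → f C y) (R? y x) sizes

  -- Each host edge in the role `ab` starts a copy of its own, which fixes `N`; the copies are then
  -- extended along the exploration from `ab`.
  initial-packing : Equalized → ∀ {a b} → Adj T a b → ∃ λ N → ∃ (Packings.IsPacking H N)
  initial-packing eqz {a} {b} ab = N , complete eqz (explore-edge T tree ab) start
    where
    E? : Decidable (λ e → R a b (proj₁ (remQuot {g} g e)) (proj₂ (remQuot {g} g e)))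
    E? e = R? a b _ _
    N = # E?
    f : Fin N → V T → Fin g
    f C t = if does (t ≟ a) then proj₁ (remQuot {g} g (select E? C)) else proj₂ (remQuot {g} g (select E? C))
    f-a : ∀ C → f C a ≡ proj₁ (remQuot {g} g (select E? C))
    f-a C with a ≟ a
    ... | yes _ = refl
    ... | no ne = ⊥-elim (ne refl)
    f-b : ∀ C → f C b ≡ proj₂ (remQuot {g} g (select E? C))
    f-b C with b ≟ a
    ... | yes e = ⊥-elim (Adj-irrefl T ab (sym e))
    ... | no _  = refl
    R-ab : ∀ C → R a b (f C a) (f C b)
    R-ab C = subst₂ (R a b) (sym (f-a C)) (sym (f-b C)) (select-∈ E? C)
    unique-ab : ∀ C C′ → f C a ≡ f C′ a → f C b ≡ f C′ b → C ≡ C′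
    unique-ab C C′ ea eb = select-injective E? C C′
      (trans (sym (combine-remQuot {g} g _)) (trans (cong₂ combine
        (trans (sym (f-a C)) (trans ea (f-a C′))) (trans (sym (f-b C)) (trans eb (f-b C′))))
        (combine-remQuot {g} g _)))
    covers-ab : ∀ u v → R a b u v → ∃ λ C → f C a ≡ u × f C b ≡ v
    covers-ab u v r = rank E? (combine u v) q , trans (f-a _) (cong proj₁ e) , trans (f-b _) (cong proj₂ e)
      where
      q : R a b (proj₁ (remQuot {g} g (combine u v))) (proj₂ (remQuot {g} g (combine u v)))
      q = subst (λ uv → R a b (proj₁ uv) (proj₂ uv)) (sym (remQuot-combine u v)) r
      e : remQuot {g} g (select E? (rank E? (combine u v) q)) ≡ (u , v)
      e = trans (cong (remQuot {g} g) (select-rank E? (combine u v) q)) (remQuot-combine u v)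
    start : PartialPacking N (a ∷ b ∷ []) f
    start = record { hom = hom′ ; unique = unique′ ; covers = covers′ ; neighbour = neighbour′ }
      where
      S = a ∷ b ∷ []
      hom′ : ∀ C s t → s ∈ S → t ∈ S → Adj T s t → R s t (f C s) (f C t)
      hom′ C s t (here refl)         (here refl)         h = ⊥-elim (Adj-irrefl T h refl)
      hom′ C s t (here refl)         (there (here refl)) h = R-ab C
      hom′ C s t (there (here refl)) (here refl)         h = R-sym (R-ab C)
      hom′ C s t (there (here refl)) (there (here refl)) h = ⊥-elim (Adj-irrefl T h refl)
      unique′ : ∀ C C′ s t → s ∈ S → t ∈ S → Adj T s t → f C s ≡ f C′ s → f C t ≡ f C′ t → C ≡ C′
      unique′ C C′ s t (here refl)         (here refl)         h es et = ⊥-elim (Adj-irrefl T h refl)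
      unique′ C C′ s t (here refl)         (there (here refl)) h es et = unique-ab C C′ es et
      unique′ C C′ s t (there (here refl)) (here refl)         h es et = unique-ab C C′ et es
      unique′ C C′ s t (there (here refl)) (there (here refl)) h es et = ⊥-elim (Adj-irrefl T h refl)
      covers′ : ∀ s t u v → s ∈ S → t ∈ S → R s t u v → ∃ λ C → f C s ≡ u × f C t ≡ v
      covers′ s t u v (here refl)         (here refl)         r = ⊥-elim (Adj-irrefl T (R-adj r) refl)
      covers′ s t u v (here refl)         (there (here refl)) r = covers-ab u v r
      covers′ s t u v (there (here refl)) (here refl)         r
        with C , ev , eu ← covers-ab v u (R-sym r) = C , eu , ev
      covers′ s t u v (there (here refl)) (there (here refl)) r = ⊥-elim (Adj-irrefl T (R-adj r) refl)
      neighbour′ : ∀ s → s ∈ S → ∃ λ t → t ∈ S × Adj T s t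
      neighbour′ s (here refl)         = b , there (here refl) , ab
      neighbour′ s (there (here refl)) = a , here refl , Adj-sym T ab

-- Colourings and degrees

ΣF≡sum : ∀ k (f : Fin k → ℕ) → ΣF k f ≡ sum f
ΣF≡sum k f = trans (cong ListAction.sum (map-tabulate id f)) (tabulated f)
  where
  tabulated : ∀ {k} (f : Fin k → ℕ) → ListAction.sum (tabulate f) ≡ sum f
  tabulated {zero}  f = refl
  tabulated {suc k} f = cong (f zero +_) (tabulated (f ∘ suc))

sum-≥-size : (f : Fin k → ℕ) → (∀ i → 1 ≤ f i) → k ≤ sum f
sum-≥-size {zero}  f pos = z≤n
sum-≥-size {suc k} f pos = +-mono-≤ (pos zero) (sum-≥-size (f ∘ suc) (pos ∘ suc))

-- The handshake count: `c u v + c v u` is 1 for adjacent `u` and `v`, and every vertex has a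
-- neighbour.
size≤2*edges : (G : Graph) → (∀ u → ∃ λ v → Adj G u v) → n G ≤ 2 * edgeCount G
size≤2*edges G nbr = begin
  n G                                                  ≤⟨ sum-≥-size (λ u → sum λ v → c u v + c v u) row ⟩
  sum (λ u → sum λ v → c u v + c v u)                  ≡⟨ sum-cong-≗ (λ u → ∑-distrib-+ (c u) (λ v → c v u)) ⟩
  sum (λ u → sum (c u) + sum λ v → c v u)              ≡⟨ ∑-distrib-+ (λ u → sum (c u)) (λ u → sum λ v → c v u) ⟩
  sum (λ u → sum (c u)) + sum (λ u → sum λ v → c v u)  ≡⟨ cong (sum (λ u → sum (c u)) +_) (∑-comm (λ u v → c v u)) ⟩
  sum (λ u → sum (c u)) + sum (λ u → sum (c u))        ≡⟨ cong₂ _+_ count (trans count (sym (+-identityʳ _))) ⟩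
  2 * edgeCount G                                      ∎
  where
  open ≤-Reasoning
  c : V G → V G → ℕ
  c u v = if adj G u v ∧ ⌊ u <? v ⌋ then 1 else 0
  count : sum (λ u → sum (c u)) ≡ edgeCount G
  count = sym (trans (ΣF≡sum (n G) _) (sum-cong-≗ λ u → ΣF≡sum (n G) (c u)))
  ordered : ∀ u v → Adj G u v → 1 ≤ c u v + c v u
  ordered u v uv with <-cmp u v
  ... | tri< u<v _ _ rewrite uv with u <? v
  ...   | yes _ = s≤s z≤n
  ...   | no ≮  = ⊥-elim (≮ u<v)
  ordered u v uv | tri≈ _ u≡v _ = ⊥-elim (Adj-irrefl G uv u≡v)
  ordered u v uv | tri> _ _ v<u rewrite Adj-sym G uv with v <? u
  ...   | yes _ = m≤n+m 1 _
  ...   | no ≮  = ⊥-elim (≮ v<u)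
  row : ∀ u → 1 ≤ sum λ v → c u v + c v u
  row u with v , uv ← nbr u = ≤-trans (ordered u v uv) (term≤sum (λ v → c u v + c v u) v)

n≤2^n : ∀ n → n ≤ 2 ^ n
n≤2^n zero    = z≤n
n≤2^n (suc n) = +-mono-≤ (m^n>0 2 n) (≤-trans (n≤2^n n) (m≤m+n _ 0))

-- Replacing each factor `n` by `2 ^ n` leaves the exponent `1 + 3n`, which is at most `7 * m`; the
-- constant 50 is far from tight.
threshold : ∀ n m → 1 ≤ m → n ≤ 2 * m → 2 * (n * (n * 2 ^ n)) ≤ 10 ^ (50 * m)
threshold n m m≥1 n≤2m = begin
  2 * (n * (n * 2 ^ n))              ≤⟨ *-monoʳ-≤ 2 (*-mono-≤ (n≤2^n n) (*-monoˡ-≤ (2 ^ n) (n≤2^n n))) ⟩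
  2 * (2 ^ n * (2 ^ n * 2 ^ n))      ≡⟨ cong (λ z → 2 * (2 ^ n * z)) (sym (^-distribˡ-+-* 2 n n)) ⟩
  2 * (2 ^ n * 2 ^ (n + n))          ≡⟨ cong (2 *_) (sym (^-distribˡ-+-* 2 n (n + n))) ⟩
  2 ^ (1 + (n + (n + n)))            ≤⟨ ^-monoʳ-≤ 2 (+-mono-≤ m≥1 (+-mono-≤ n≤2m (+-mono-≤ n≤2m n≤2m))) ⟩
  2 ^ (m + (2 * m + (2 * m + 2 * m))) ≡⟨ cong (2 ^_) (seven-fold m) ⟩
  2 ^ (7 * m)                        ≤⟨ ^-monoʳ-≤ 2 (*-monoˡ-≤ m (m≤m+n 7 43)) ⟩
  2 ^ (50 * m)                       ≤⟨ ^-monoˡ-≤ (50 * m) (m≤m+n 2 8) ⟩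
  10 ^ (50 * m)                      ∎
  where
  open ≤-Reasoning

-- Edges as unordered pairs

module _ {G : Graph} where

  Ends : V G → V G → Edge G → Set
  Ends x y e = (lo e ≡ x × hi e ≡ y) ⊎ (lo e ≡ y × hi e ≡ x)

  Ends-sym : ∀ {x y e} → Ends x y e → Ends y x e
  Ends-sym (inj₁ p) = inj₂ p
  Ends-sym (inj₂ p) = inj₁ p

  edge-≡ : {e f : Edge G} → lo e ≡ lo f → hi e ≡ hi f → e ≡ f
  edge-≡ {edge u v lt h} {edge .u .v lt′ h′} refl refl =
    cong₂ (edge u v) (≤-irrelevant lt lt′) (uip h h′)

  ends-determine : ∀ {x y} (e f : Edge G) → Ends x y e → Ends x y f → e ≡ f
  ends-determine e f (inj₁ (p , q)) (inj₁ (p′ , q′)) = edge-≡ (trans p (sym p′)) (trans q (sym q′))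
  ends-determine e f (inj₂ (p , q)) (inj₂ (p′ , q′)) = edge-≡ (trans p (sym p′)) (trans q (sym q′))
  -- Opposite orientations would contradict `lo < hi` for one of the two edges.
  ends-determine e f (inj₁ (refl , refl)) (inj₂ (refl , refl)) = ⊥-elim (<-asym (lt e) (lt f))
  ends-determine e f (inj₂ (refl , refl)) (inj₁ (refl , refl)) = ⊥-elim (<-asym (lt e) (lt f))

  ends-common : ∀ {x y x′ y′} (e : Edge G) → Ends x y e → Ends x′ y′ e →
    (x ≡ x′ × y ≡ y′) ⊎ (x ≡ y′ × y ≡ x′)
  ends-common e (inj₁ (p , q)) (inj₁ (p′ , q′)) = inj₁ (trans (sym p) p′ , trans (sym q) q′)
  ends-common e (inj₁ (p , q)) (inj₂ (p′ , q′)) = inj₂ (trans (sym p) p′ , trans (sym q) q′)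
  ends-common e (inj₂ (p , q)) (inj₁ (p′ , q′)) = inj₂ (trans (sym q) q′ , trans (sym p) p′)
  ends-common e (inj₂ (p , q)) (inj₂ (p′ , q′)) = inj₁ (trans (sym q) q′ , trans (sym p) p′)

  mkEdge-ends : ∀ x y (h : Adj G x y) → Ends x y (mkEdge G x y h)
  mkEdge-ends x y h with <-cmp x y
  ... | tri< _ _ _ = inj₁ (refl , refl)
  ... | tri> _ _ _ = inj₂ (refl , refl)
  mkEdge-ends x .x h | tri≈ _ refl _ = ⊥-elim (Adj-irrefl G h refl)

  mkEdge-sym : ∀ x y (h : Adj G x y) (h′ : Adj G y x) → mkEdge G x y h ≡ mkEdge G y x h′
  mkEdge-sym x y h h′ = ends-determine _ _ (mkEdge-ends x y h) (Ends-sym {e = mkEdge G y x h′} (mkEdge-ends y x h′))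

  mkEdge-own : (e : Edge G) → mkEdge G (lo e) (hi e) (isE e) ≡ e
  mkEdge-own e = ends-determine _ e (mkEdge-ends _ _ (isE e)) (inj₁ (refl , refl))

  sameEdge-sound : (e f : Edge G) → sameEdge e f ≡ true → e ≡ f
  sameEdge-sound e f same with lo e ≟ lo f | hi e ≟ hi f
  ... | yes p | yes q = edge-≡ p q
  sameEdge-sound e f () | yes _ | no _
  sameEdge-sound e f () | no _  | _

  sameEdge-refl : (e : Edge G) → sameEdge e e ≡ true
  sameEdge-refl e with lo e ≟ lo e | hi e ≟ hi e
  ... | yes _ | yes _ = refl
  ... | no ne | _     = ⊥-elim (ne refl)
  ... | yes _ | no ne = ⊥-elim (ne refl)

  _≟ᴱ_ : (e f : Edge G) → Dec (e ≡ f)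
  e ≟ᴱ f = map′ (sameEdge-sound e f) (λ { refl → sameEdge-refl e }) (sameEdge e f Bool.≟ true)

-- H x and H tt are convertible but not syntactically equal, so that the with-abstraction
-- below keeps the left-hand side of the equation adj (H x) v w ≡ b.
degInd-cases′ : ∀ (H : ⊤ → Graph) (x : ⊤) T (φ : Colouring (H x) T) i v w →
  (Σ (Adj (H x) v w) λ h → φ (mkEdge (H x) v w h) ≡ i × degInd (H tt) T φ i v w ≡ 1) ⊎
  ((∀ h → φ (mkEdge (H x) v w h) ≢ i) × degInd (H tt) T φ i v w ≡ 0)
degInd-cases′ H x T φ i v w with adj (H tt) v w | (adj (H x) v w ≡ adj (H tt) v w) ∋ refl
... | false | eq = inj₂ ((λ h → ⊥-elim (bad (trans (sym eq) h))) , refl)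
  where
  bad : ¬ (false ≡ true)
  bad ()
... | true | eq with φ (mkEdge (H x) v w eq) ≟ᴱ i
...   | yes e = inj₁ (eq , e , cong (λ b → if b then 1 else 0)
          (trans (cong (λ f → sameEdge f i) e) (sameEdge-refl i)))
...   | no ne = inj₂ ((λ h e → ne (trans (cong (λ h → φ (mkEdge (H x) v w h)) (uip eq h)) e)) ,
          cong (λ b → if b then 1 else 0) (Bool.¬-not λ same → ne (sameEdge-sound _ i same)))

degInd-cases : ∀ G T (φ : Colouring G T) i v w →
  (Σ (Adj G v w) λ h → φ (mkEdge G v w h) ≡ i × degInd G T φ i v w ≡ 1) ⊎
  ((∀ h → φ (mkEdge G v w h) ≢ i) × degInd G T φ i v w ≡ 0)
degInd-cases G = degInd-cases′ (λ _ → G) tt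

other-side : ∀ (b : Bool) {c d} → b ≢ c → d ≢ c → b ≡ d
other-side false {false} b≢c d≢c = ⊥-elim (b≢c refl)
other-side false {true}  {false} b≢c d≢c = refl
other-side false {true}  {true}  b≢c d≢c = ⊥-elim (d≢c refl)
other-side true  {true}  b≢c d≢c = ⊥-elim (b≢c refl)
other-side true  {false} {true}  b≢c d≢c = refl
other-side true  {false} {false} b≢c d≢c = ⊥-elim (d≢c refl)

-- The pattern of an equitable colouring, and the decomposition from a packing

module _ (T G : Graph) (sG : V G → Bool) (bipG : IsBipartition G sG)
  (sT : V T → Bool) (bipT : IsBipartition T sT) (φ : Colouring G T) where

  -- The colour of `uv` names a tree edge without orientation; the side condition decides which end
  -- of `uv` plays `a`.
  Role : V T → V T → V G → V G → Set
  Role a b u v = Σ (Adj T a b) λ h → Σ (Adj G u v) λ k →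
    sG u ≡ sT a × φ (mkEdge G u v k) ≡ mkEdge T a b h

  opaque
    Role? : ∀ a b u v → Dec (Role a b u v)
    Role? a b u v with adj T a b Bool.≟ true | adj G u v Bool.≟ true
    ... | no ¬h | _     = no (¬h ∘ proj₁)
    ... | yes _ | no ¬k = no (¬k ∘ proj₁ ∘ proj₂)
    ... | yes h | yes k = map′ (λ p → h , k , p) forget
      ((sG u Bool.≟ sT a) ×-dec (φ (mkEdge G u v k) ≟ᴱ mkEdge T a b h))
      where
      forget : Role a b u v → sG u ≡ sT a × φ (mkEdge G u v k) ≡ mkEdge T a b h
      forget (h′ , k′ , side , col) with refl ← uip h h′ | refl ← uip k k′ =
        side , col

  Role-sym : ∀ {a b u v} → Role a b u v → Role b a v u
  Role-sym {a} {b} {u} {v} (h , k , side , col) = Adj-sym T h , Adj-sym G k ,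
    other-side (sG v) (λ e → bipG u v k (sym e)) (λ e → bipT a b h (trans (sym side) (sym e))) ,
    trans (cong φ (mkEdge-sym v u (Adj-sym G k) k)) (trans col (mkEdge-sym a b h (Adj-sym T h)))

  Role-colour : ∀ {a b a′ b′ u v} → Role a b u v → Role a′ b′ u v → a ≡ a′ × b ≡ b′
  Role-colour {a} {b} {a′} {b′} {u} {v} (h , k , side , col) (h′ , k′ , side′ , col′)
    with ends-common (φ (mkEdge G u v k))
           (subst (Ends a b) (sym col) (mkEdge-ends a b h))
           (subst (Ends a′ b′) (sym (trans (cong (φ ∘ mkEdge G u v) (uip k k′)) col′))
             (mkEdge-ends a′ b′ h′))
  ... | inj₁ same = same
  -- Reversed roles would put both ends of the tree edge on the side of `u`.
  ... | inj₂ (refl , refl) = ⊥-elim (bipT a b h (trans (sym side) side′))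

  role-of-edge : ∀ {u v} (k : Adj G u v) → ∃₂ λ a b → Role a b u v
  role-of-edge {u} {v} k with sG u Bool.≟ sT (lo c)
    where c = φ (mkEdge G u v k)
  ... | yes side = lo c , hi c , isE c , k , side , sym (mkEdge-own c)
    where c = φ (mkEdge G u v k)
  ... | no other = hi c , lo c , Adj-sym T (isE c) , k ,
    other-side (sG u) other (λ e → bipT (lo c) (hi c) (isE c) (sym e)) ,
    sym (trans (mkEdge-sym (hi c) (lo c) (Adj-sym T (isE c)) (isE c)) (mkEdge-own c))
    where c = φ (mkEdge G u v k)

  -- For `u` on the side of `a` the side condition holds automatically, so the two counts agree term
  -- by term.
  degree-role : ∀ {a b} (h : Adj T a b) u → sG u ≡ sT a →
    deg G T φ (mkEdge T a b h) u ≡ # (Role? a b u)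
  degree-role {a} {b} h u side = trans (ΣF≡sum (n G) _) (sum-cong-≗ pointwise)
    where
    pointwise : ∀ v → degInd G T φ (mkEdge T a b h) u v ≡ 𝟙 (Role? a b u v)
    pointwise v with degInd-cases G T φ (mkEdge T a b h) u v
    ... | inj₁ (k , col , one)  = trans one (sym (𝟙-yes (Role? a b u v) (h , k , side , col)))
    ... | inj₂ (none , zero≡) = trans zero≡ (sym (𝟙-no (Role? a b u v)
      λ { (h′ , k , _ , col) → none k (trans col (cong (mkEdge T a b) (uip h′ h))) }))

  pattern-of : ∀ D → (∀ v i → D ≤ deg G T φ i v) → Pattern T (n G) D
  pattern-of D large = record
    { R = Role ; R? = Role? ; R-adj = proj₁ ; R-sym = Role-sym ; R-colour = Role-colour
    ; R-≢ = λ r → Adj-irrefl G (proj₁ (proj₂ r))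
    ; R-degree = λ { {u = u} h (_ , _ , side , _) →
        ≤-trans (large u (mkEdge T _ _ h)) (≤-reflexive (degree-role h u side)) } }

  mkEdge-incident : ∀ {a b} (h : Adj T a b) → Incident T a (mkEdge T a b h)
  mkEdge-incident {a} {b} h with mkEdge-ends a b h
  ... | inj₁ (p , _) = inj₁ p
  ... | inj₂ (_ , p) = inj₂ p

  equalized : Equitable G T sG sT φ → ∀ y x x′ u → Adj T y x → Adj T y x′ →
    # (Role? y x u) ≡ # (Role? y x′ u)
  equalized equit y x x′ u h h′ with sG u Bool.≟ sT y
  ... | yes side = trans (sym (degree-role h u side))
    (trans (equit u y side _ _ (mkEdge-incident h) (mkEdge-incident h′)) (degree-role h′ u side))
  -- A vertex on the side opposite to `y` never plays `y`, so both counts vanish and equitability is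
  -- not called upon.
  ... | no other = trans (#-zero (Role? y x u) (λ w r → other (proj₁ (proj₂ (proj₂ r)))))
    (sym (#-zero (Role? y x′ u) (λ w r → other (proj₁ (proj₂ (proj₂ r))))))

  decomposition : ∀ {D} (large : ∀ v i → D ≤ deg G T φ i v) → ∀ {N} f →
    Packings.IsPacking (pattern-of D large) N f →
    (∀ C → ¬ Packings.Degenerate (pattern-of D large) N (f C)) → TDecomposition T G
  decomposition {D} large {N} f p inj = record
    { k = N ; part = part ; emb = f ; emb-inj = emb-inj ; emb-edge = emb-edge ; emb-onto = emb-onto }
    where
    open Packings.IsPacking p
    Copy : Edge G → Set
    Copy e = ∃₂ λ a b → Role a b (lo e) (hi e) × ∃ λ C → f C a ≡ lo e × f C b ≡ hi e
    index : ∀ {e} → Copy e → Fin N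
    index (_ , _ , _ , C , _) = C
    copy : ∀ e → Copy e
    copy e = let a , b , r = role-of-edge (isE e) in a , b , r , covers a b (lo e) (hi e) r
    part : Edge G → Fin N
    part e = index {e} (copy e)
    emb-inj : ∀ C a b → f C a ≡ f C b → a ≡ b
    emb-inj C a b e with a ≟ b
    ... | yes a≡b = a≡b
    ... | no a≢b  = ⊥-elim (inj C (a , b , a≢b , e))
    part-of : ∀ C a b e → Role a b (lo e) (hi e) → lo e ≡ f C a → hi e ≡ f C b → part e ≡ C
    part-of C a b e r p q = same (copy e)
      where
      same : (c : Copy e) → index {e} c ≡ C
      same (a′ , b′ , r′ , C′ , eu , ev) with refl , refl ← Role-colour r r′ =
        unique C′ C a b (proj₁ r) (trans eu p) (trans ev q)
    emb-edge : ∀ C a b → Adj T a b → Σ (Adj G (f C a) (f C b)) λ h → part (mkEdge G _ _ h) ≡ C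
    emb-edge C a b ab = adjacent , here-part (mkEdge-ends (f C a) (f C b) adjacent)
      where
      r : Role a b (f C a) (f C b)
      r = hom C a b ab
      adjacent : Adj G (f C a) (f C b)
      adjacent = proj₁ (proj₂ r)
      e : Edge G
      e = mkEdge G (f C a) (f C b) adjacent
      here-part : Ends (f C a) (f C b) e → part e ≡ C
      here-part (inj₁ (p , q)) = part-of C a b e (subst₂ (Role a b) (sym p) (sym q) r) p q
      -- `mkEdge` may store the edge in reverse, in which case the two roles are exchanged.
      here-part (inj₂ (p , q)) = part-of C b a e (subst₂ (Role b a) (sym p) (sym q) (Role-sym r)) p q
    emb-onto : ∀ e → Σ (V T) λ a → Σ (V T) λ b →
      Adj T a b × (lo e ≡ f (part e) a) × (hi e ≡ f (part e) b)
    emb-onto e = let a , b , r , C , eu , ev = copy e in a , b , proj₁ r , sym eu , sym ev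

first-step : ∀ {G u v} → Walk G u v → u ≢ v → ∃ λ w → Adj G u w
first-step nil        u≢v = ⊥-elim (u≢v refl)
first-step (cons h _) _   = _ , h

order-and-size-bounds : ∀ {G} m → edgeCount G ≡ m → ∀ {a b} → Adj G a b → Connected G → n G ≤ 2 * m × 1 ≤ m
order-and-size-bounds {G} m refl {a} {b} ab connected = small , positive (edgeCount G) (≤-trans (size≥1 a) small)
  where
  nbr : ∀ u → ∃ λ v → Adj G u v
  nbr u with u ≟ a
  ... | yes refl = b , ab
  ... | no u≢a   = first-step (connected u a) u≢a
  small : n G ≤ 2 * edgeCount G
  small = size≤2*edges G nbr
  size≥1 : ∀ {k} → Fin k → 1 ≤ k
  size≥1 {suc k} _ = s≤s z≤n
  positive : ∀ m → 1 ≤ 2 * m → 1 ≤ m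
  positive (suc m) _ = s≤s z≤n

theorem5 : (T G : Graph) (m : ℕ) → IsTree T → edgeCount T ≡ m →
    (sG : V G → Bool) → IsBipartition G sG →
    (sT : V T → Bool) → IsBipartition T sT →
    (φ : Colouring G T) → Equitable G T sG sT φ →
    (∀ (v : V G) (i : Edge T) → 10 ^ (50 * m) ≤ deg G T φ i v) →
    TDecomposition T G
theorem5 T G m tree edges sG bipG sT bipT φ equit large
  with any? (λ a → any? λ b → adj T a b Bool.≟ true)
-- An edge of `G` would be coloured by an edge of `T`, so here `G` has no edges and the
-- decomposition has no parts.
... | no edgeless = record
  { k = 0 ; part = λ e → ⊥-elim (impossible e) ; emb = λ () ; emb-inj = λ () ; emb-edge = λ ()
  ; emb-onto = λ e → ⊥-elim (impossible e) }
  where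
  impossible : ¬ Edge G
  impossible e = edgeless (lo (φ e) , hi (φ e) , isE (φ e))
... | yes (a , b , ab) =
  let small , m≥1 = order-and-size-bounds m edges ab (proj₁ (proj₂ tree))
      H = pattern-of T G sG bipG sT bipT φ (10 ^ (50 * m)) large
      N , f , p = Initial.initial-packing H tree (equalized T G sG bipG sT bipT φ equit) ab
      f′ , p′ , inj = Packings.LocalLemma.nondegenerate-packing H N tree (threshold (n T) m m≥1 small) ab f p
  in decomposition T G sG bipG sT bipT φ large f′ p′ inj
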